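{- Let $\mathbb F$ be a field, let $d\ge 2$ and $n\ge 1$ be integers, and let $T\in(\mathbb F^n)^{\otimes d}$ be a $d$-mode tensor. Then $$\eta(T)\ \le\ \frac 2d\bigl(\mathrm{ltw}(K_d)+1\bigr)\ =\ \frac d2+1-\frac{7+(-1)^d}{4d}.$$
   Context: A $d$-mode tensor over $\mathbb F$ is a polynomial in variables partitioned into $d$ nonempty disjoint sets $X_1,\dots,X_d$ (modes) all of whose monomials contain exactly one variable from each mode, with degree one; $(\mathbb F^n)^{\otimes d}$ denotes those in which each mode has $n$ variables. The Kronecker product $S\otimes T$ of $d$-mode tensors with modes $X_i$ and $Y_i$ is the polynomial product $ST$, viewed as a $d$-mode tensor with modes $X_i\times Y_i$ (a product $xy$ with $x\in X_i$, $y\in Y_i$ is regarded as one variable); $T^{\otimes k}$ is the $k$-fold Kronecker power. An arithmetic circuit is a directed acyclic graph whose sources (inputs) are labeled by field elements or variables, whose other vertices (gates) are labeled $+$ or $\times$ (with arbitrary fan-in), and whose edges (wires) are labeled by field elements by which the transmitted value is multiplied; its size is the number of wires, and $\mathrm C(T)$ is the minimum size of an arithmetic circuit over $\mathbb F$ computing $T$. For $T\in(\mathbb F^n)^{\otimes d}$, the exponent of asymptotic circuit complexity is $\eta(T)=\inf\{\beta\ge 0:\mathrm C(T^{\otimes k})=O(n^{\beta k})\text{ as }k\to\infty\}$. $K_d$ is the complete graph on $d$ vertices, and $\mathrm{ltw}(G)$ is the treewidth of the line graph $L(G)$ of $G$ (vertices of $L(G)$ are the edges of $G$; two are adjacent if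 they share a vertex). -}

module Defs where

open import Level using (Level; _⊔_)
open import Algebra.Bundles using (CommutativeRing; CommutativeSemiring)
open import Algebra.Apartness.Bundles using (HeytingField)
import Algebra.Definitions.RawSemiring as RawSemiringDefinitions
open import Data.Fin.Base as Fin using (Fin; zero; suc)
open import Data.Integer.Base using (∣_∣)
open import Data.List.Base as List using (List)
open import Data.List.Membership.Propositional using (_∈_)
open import Data.List.NonEmpty.Base as List⁺ using (List⁺)
open import Data.List.Relation.Unary.Unique.Propositional using (Unique)
open import Data.Nat.Base as ℕ using (ℕ; zero; suc)
open import Data.Product.Base using (Σ-syntax; ∃-syntax; _×_; _,_; proj₂)
open import Data.Rational.Base as ℚ using (ℚ; ↥_; ↧ₙ_)
open import Data.Sum.Base using (_⊎_; inj₁; inj₂)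
open import Data.Vec.Base as Vec using (Vec; []; _∷_)
import Data.Vec.Functional as VecF
open import Relation.Binary.Construct.Closure.ReflexiveTransitive using (Star)
open import Relation.Binary.PropositionalEquality.Core using (_≡_; _≢_; refl; ≢-sym)
open import Relation.Nullary.Negation.Core using (¬_)

-- A Heyting field with decidable equality is a field in the discrete
-- sense; classically the two notions coincide.

module _ {c ℓ₁ ℓ₂ : Level} (𝔽 : HeytingField c ℓ₁ ℓ₂) where

  private
    module 𝔽 = HeytingField 𝔽

  infixl 6 _+ᴾ_
  infixl 7 _*ᴾ_
  infix  4 _≈ᴾ_

  -- 𝔽[V] as the free commutative 𝔽-algebra on V: formal expressions
  -- modulo the laws of commutative 𝔽-algebras.  These are formal
  -- polynomials, not functions, which matters when 𝔽 is finite.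

  data Poly {v : Level} (V : Set v) : Set (c ⊔ v) where
    con       : 𝔽.Carrier → Poly V
    var       : V → Poly V
    _+ᴾ_ _*ᴾ_ : Poly V → Poly V → Poly V

  data _≈ᴾ_ {v : Level} {V : Set v} : Poly V → Poly V → Set (c ⊔ ℓ₁ ⊔ v) where
    ≈-refl      : ∀ {p} → p ≈ᴾ p
    ≈-sym       : ∀ {p q} → p ≈ᴾ q → q ≈ᴾ p
    ≈-trans     : ∀ {p q r} → p ≈ᴾ q → q ≈ᴾ r → p ≈ᴾ r
    +-cong      : ∀ {p p′ q q′} → p ≈ᴾ p′ → q ≈ᴾ q′ → p +ᴾ q ≈ᴾ p′ +ᴾ q′
    *-cong      : ∀ {p p′ q q′} → p ≈ᴾ p′ → q ≈ᴾ q′ → p *ᴾ q ≈ᴾ p′ *ᴾ q′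
    +-assoc     : ∀ p q r → (p +ᴾ q) +ᴾ r ≈ᴾ p +ᴾ (q +ᴾ r)
    +-comm      : ∀ p q → p +ᴾ q ≈ᴾ q +ᴾ p
    +-identityˡ : ∀ p → con 𝔽.0# +ᴾ p ≈ᴾ p
    *-assoc     : ∀ p q r → (p *ᴾ q) *ᴾ r ≈ᴾ p *ᴾ (q *ᴾ r)
    *-comm      : ∀ p q → p *ᴾ q ≈ᴾ q *ᴾ p
    *-identityˡ : ∀ p → con 𝔽.1# *ᴾ p ≈ᴾ p
    distribˡ    : ∀ p q r → p *ᴾ (q +ᴾ r) ≈ᴾ (p *ᴾ q) +ᴾ (p *ᴾ r)
    zeroˡ       : ∀ p → con 𝔽.0# *ᴾ p ≈ᴾ con 𝔽.0#
    con-cong    : ∀ {a b} → a 𝔽.≈ b → con a ≈ᴾ con b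
    con-+       : ∀ a b → con (a 𝔽.+ b) ≈ᴾ con a +ᴾ con b
    con-*       : ∀ a b → con (a 𝔽.* b) ≈ᴾ con a *ᴾ con b

  -ᴾ_ : {v : Level} {V : Set v} → Poly V → Poly V
  -ᴾ p = con (𝔽.- 𝔽.1#) *ᴾ p

  private
    -‿inverseˡ : {v : Level} {V : Set v} (p : Poly V) → (-ᴾ p) +ᴾ p ≈ᴾ con 𝔽.0#
    -‿inverseˡ p =
      ≈-trans (+-cong (*-comm _ p) (≈-trans (≈-sym (*-identityˡ p)) (*-comm _ p)))
      (≈-trans (≈-sym (distribˡ p _ _))
      (≈-trans (*-comm p _)
      (≈-trans (*-cong (≈-trans (≈-sym (con-+ _ _)) (con-cong (𝔽.-‿inverseˡ 𝔽.1#))) ≈-refl)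
      (zeroˡ p))))

    distribʳ : {v : Level} {V : Set v} (p q r : Poly V) →
               (q +ᴾ r) *ᴾ p ≈ᴾ (q *ᴾ p) +ᴾ (r *ᴾ p)
    distribʳ p q r =
      ≈-trans (*-comm _ p) (≈-trans (distribˡ p q r) (+-cong (*-comm p q) (*-comm p r)))

  polyRing : {v : Level} → Set v → CommutativeRing (c ⊔ v) (c ⊔ ℓ₁ ⊔ v)
  polyRing V = record
    { Carrier = Poly V
    ; _≈_ = _≈ᴾ_
    ; _+_ = _+ᴾ_
    ; _*_ = _*ᴾ_
    ; -_  = -ᴾ_
    ; 0#  = con 𝔽.0#
    ; 1#  = con 𝔽.1#
    ; isCommutativeRing = record
      { isRing = record
        { +-isAbelianGroup = record
          { isGroup = record
            { isMonoid = record
              { isSemigroup = record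
                { isMagma = record
                  { isEquivalence = record { refl = ≈-refl ; sym = ≈-sym ; trans = ≈-trans }
                  ; ∙-cong = +-cong
                  }
                ; assoc = +-assoc
                }
              ; identity = +-identityˡ , λ p → ≈-trans (+-comm p _) (+-identityˡ p)
              }
            ; inverse = -‿inverseˡ , λ p → ≈-trans (+-comm p _) (-‿inverseˡ p)
            ; ⁻¹-cong = *-cong ≈-refl
            }
          ; comm = +-comm
          }
        ; *-cong = *-cong
        ; *-assoc = *-assoc
        ; *-identity = *-identityˡ , λ p → ≈-trans (*-comm p _) (*-identityˡ p)
        ; distrib = distribˡ , distribʳ
        }
      ; *-comm = *-comm
      }
    }

  module _ {v : Level} {V : Set v} where
    open RawSemiringDefinitions (CommutativeSemiring.rawSemiring (CommutativeRing.commutativeSemiring (polyRing V))) public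
      using () renaming (sum to sumᴾ; product to productᴾ)

  sumVec : {v : Level} {V : Set v} {n : ℕ} (d : ℕ) → (Vec (Fin n) d → Poly V) → Poly V
  sumVec zero    f = f []
  sumVec (suc d) f = sumᴾ λ i → sumVec d λ j → f (i ∷ j)

  -- A tensor in (𝔽ⁿ)^⊗d, given by its coefficients: the entry at
  -- (j₁ , … , j_d) is the coefficient of x_{1,j₁} ⋯ x_{d,j_d}.

  Tensor : (d n : ℕ) → Set c
  Tensor d n = Vec (Fin n) d → 𝔽.Carrier

  -- (i , j) is the j-th variable of the i-th mode.

  TVar : (d n : ℕ) → Set
  TVar d n = Fin d × Fin n

  toPoly : {d n : ℕ} → Tensor d n → Poly (TVar d n)
  toPoly {d} T = sumVec d λ j → con (T j) *ᴾ productᴾ λ i → var (i , Vec.lookup j i)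

  infixl 7 _⊗_
  infix  8 _^⊗_

  -- Fin (m * n) stands for Fin m × Fin n, so that the variable with
  -- index combine a b in mode i plays the role of the product x_{i,a} y_{i,b}.

  _⊗_ : {d m n : ℕ} → Tensor d m → Tensor d n → Tensor d (m ℕ.* n)
  _⊗_ {d} {m} {n} S T j =
    S (Vec.map (Fin.quotient n) j) 𝔽.* T (Vec.map (Fin.remainder {m} n) j)

  _^⊗_ : {d n : ℕ} → Tensor d n → (k : ℕ) → Tensor d (n ℕ.^ k)
  T ^⊗ zero  = λ _ → 𝔽.1#
  T ^⊗ suc k = T ⊗ (T ^⊗ k)

  data Op : Set where
    add mul : Op

  -- n counts the earlier vertices.  A wire is a field element
  -- together with its source; a gate has at least one incoming wire, and
  -- no two wires join the same pair of vertices.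

  data Vertex (V : Set) (n : ℕ) : Set c where
    input : 𝔽.Carrier ⊎ V → Vertex V n
    gate  : Op → (ws : List⁺ (𝔽.Carrier × Fin n)) →
            Unique (List.map proj₂ (List⁺.toList ws)) → Vertex V n

  infixl 5 _▷_

  -- A DAG listed in a topological order; index zero is the latest vertex.

  data Circuit (V : Set) : ℕ → Set c where
    ∅   : Circuit V 0
    _▷_ : {n : ℕ} → Circuit V n → Vertex V n → Circuit V (suc n)

  indegree : {V : Set} {n : ℕ} → Vertex V n → ℕ
  indegree (input _)     = 0
  indegree (gate _ ws _) = List⁺.length ws

  size : {V : Set} {n : ℕ} → Circuit V n → ℕ
  size ∅       = 0
  size (C ▷ x) = size C ℕ.+ indegree x

  applyOp : {V : Set} → Op → List (Poly V) → Poly V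
  applyOp add = List.foldr _+ᴾ_ (con 𝔽.0#)
  applyOp mul = List.foldr _*ᴾ_ (con 𝔽.1#)

  vertexValue : {V : Set} {n : ℕ} → (Fin n → Poly V) → Vertex V n → Poly V
  vertexValue ρ (input (inj₁ a)) = con a
  vertexValue ρ (input (inj₂ x)) = var x
  vertexValue ρ (gate o ws _)    =
    applyOp o (List.map (λ (a , u) → con a *ᴾ ρ u) (List⁺.toList ws))

  value : {V : Set} {n : ℕ} → Circuit V n → Fin n → Poly V
  value (C ▷ x) zero    = vertexValue (value C) x
  value (C ▷ x) (suc u) = value C u

  Computes : {V : Set} {n : ℕ} → Circuit V n → Poly V → Set (c ⊔ ℓ₁)
  Computes C p = ∃[ u ] value C u ≈ᴾ p

  -- C(T) ≤ s, where C(T) is the minimum size of a circuit computing T.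

  C[_]≤_ : {d n : ℕ} → Tensor d n → ℕ → Set (c ⊔ ℓ₁)
  C[_]≤_ {d} {n} T s =
    ∃[ N ] Σ[ C ∈ Circuit (TVar d n) N ] Computes C (toPoly T) × size C ℕ.≤ s

  -- β ≥ 0 and C(T^⊗k) = O(n^(βk)) as k → ∞.  For β = a / b the inequality
  -- s ≤ r · n^(βk) is written as s^b ≤ r^b · n^(ak).

  IsGrowthExponent : {d n : ℕ} → Tensor d n → ℚ → Set (c ⊔ ℓ₁)
  IsGrowthExponent {d} {n} T β =
    ℚ.NonNegative β ×
    ∃[ r ] ∃[ K ] ∀ k → K ℕ.≤ k →
      ∃[ s ] (C[ T ^⊗ k ]≤ s) × s ℕ.^ b ℕ.≤ r ℕ.^ b ℕ.* n ℕ.^ (a ℕ.* k)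
    where
    a b : ℕ
    a = ∣ ↥ β ∣
    b = ↧ₙ β

  -- η(T) ≤ q, where η(T) is the infimum of the growth exponents.  For n ≥ 1
  -- the real growth exponents form an upward closed set, so that restricting
  -- to rational ones does not change the infimum.

  η[_]≤_ : {d n : ℕ} → Tensor d n → ℚ → Set (c ⊔ ℓ₁)
  η[ T ]≤ q = ∀ ε → ℚ.Positive ε → ∃[ β ] IsGrowthExponent T β × β ℚ.< q ℚ.+ ε

record Graph (V : Set) : Set₁ where
  field
    Adj        : V → V → Set
    Adj-sym    : ∀ {u v} → Adj u v → Adj v u
    Adj-irrefl : ∀ {v} → ¬ Adj v v

open Graph

K : (d : ℕ) → Graph (Fin d)
K d = record
  { Adj        = _≢_
  ; Adj-sym    = ≢-sym
  ; Adj-irrefl = λ v≢v → v≢v refl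
  }

-- The unordered pair {u , v} is stored with u < v; the proofs are
-- irrelevant, so an edge is determined by its endpoints.

record Edge {n : ℕ} (G : Graph (Fin n)) : Set where
  constructor edge
  field
    u v  : Fin n
    .u<v : u Fin.< v
    .uv  : Adj G u v

infix 4 _∈ᴱ_

_∈ᴱ_ : {n : ℕ} {G : Graph (Fin n)} → Fin n → Edge G → Set
x ∈ᴱ e = x ≡ Edge.u e ⊎ x ≡ Edge.v e

LineGraph : {n : ℕ} (G : Graph (Fin n)) → Graph (Edge G)
LineGraph G = record
  { Adj        = λ e f → e ≢ f × ∃[ x ] (x ∈ᴱ e × x ∈ᴱ f)
  ; Adj-sym    = λ (e≢f , x , x∈e , x∈f) → ≢-sym e≢f , x , x∈f , x∈e
  ; Adj-irrefl = λ (e≢e , _) → e≢e refl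
  }

-- Finite nonempty trees: every such tree arises from a single node by
-- repeatedly attaching a leaf.  The most recently attached leaf is zero.

data Tree : ℕ → Set where
  single : Tree 1
  attach : {m : ℕ} → Tree m → Fin m → Tree (suc m)

data TreeAdj : {m : ℕ} → Tree m → Fin m → Fin m → Set where
  down : {m : ℕ} {t : Tree m} {p : Fin m} → TreeAdj (attach t p) (suc p) zero
  up   : {m : ℕ} {t : Tree m} {p : Fin m} → TreeAdj (attach t p) zero (suc p)
  old  : {m : ℕ} {t : Tree m} {p x y : Fin m} →
         TreeAdj t x y → TreeAdj (attach t p) (suc x) (suc y)

record TreeDecomposition {V : Set} (G : Graph V) : Set where
  field
    nodes       : ℕ
    tree        : Tree nodes
    bag         : Fin nodes → List V
    bag-unique  : ∀ x → Unique (bag x)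
    vertex-bag  : ∀ v → ∃[ x ] v ∈ bag x
    edge-bag    : ∀ u v → Adj G u v → ∃[ x ] (u ∈ bag x × v ∈ bag x)
    -- the nodes whose bags contain v induce a connected subgraph of the tree
    connected   : ∀ v x y → v ∈ bag x → v ∈ bag y →
                  Star (λ a b → TreeAdj tree a b × v ∈ bag a × v ∈ bag b) x y

  -- For a graph without vertices this gives 0 rather than -1.
  width : ℕ
  width = VecF.foldr ℕ._⊔_ 0 (λ x → List.length (bag x)) ℕ.∸ 1

IsTreewidth : {V : Set} → Graph V → ℕ → Set
IsTreewidth G w =
  (Σ[ D ∈ TreeDecomposition G ] TreeDecomposition.width D ≡ w) ×
  (∀ (D : TreeDecomposition G) → w ℕ.≤ TreeDecomposition.width D)

{-# OPTIONS --safe #-}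
module Submission where

-- Expanding the v-th of d copies of T^⊗m along the star centred at mode v turns
-- T^⊗(d m) into a tensor network on K_d whose edges carry labels in [n^m]².  When
-- its vertices are contracted one after the other, the step after the first i ones
-- involves only the (i + 1) (d - i) - 1 edges that end at the current vertex or join
-- an earlier vertex to a later one.  These edge sets are the bags of a path
-- decomposition of L(K_d), and the largest one has h g + h + g elements, where
-- d = h + g + 1 and h - g is 0 or 1.  The k mod d leftover factors of T^⊗k cost a
-- constant factor only.  For d = 2 the sums at the vertices would dominate;
-- there L copies are contracted one index at a time instead, which gives the
-- exponent (L + 1) / L for every L.
--
-- Conversely, deleting fewer than h g + h + g edges from K_d leaves a component
-- with more than half of the vertices, up to a tie-break for even d.  If all bags of
-- a tree decomposition of L(K_d) were that small, the subtrees of the bags that meet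
-- these components would intersect pairwise, so by the Helly property one bag would
-- meet all of them, including the component that avoids this very bag.

open import Defs
open import Level using (Level; _⊔_)
open import Algebra.Apartness.Bundles using (HeytingField)
open import Algebra.Bundles using (CommutativeRing)
import Algebra.Properties.Semiring.Sum as SumProperties
open import Data.Empty using (⊥; ⊥-elim; ⊥-elim-irr)
open import Data.Fin.Base as Fin
  using (Fin; zero; suc; toℕ; combine; quotient; remainder; _↑ˡ_; _↑ʳ_; inject; inject₁; opposite; fromℕ<)
open import Data.Fin.Induction using (<-weakInduction)
open import Data.Fin.Properties as Fin
  using (_≟_; any?; remQuot-combine; toℕ-injective; toℕ-inject; toℕ-fromℕ<; toℕ<n; opposite-prop; opposite-involutive)
open import Data.Integer.Base as ℤ using (∣_∣)
import Data.Integer.Properties as ℤ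
open import Data.List.Base as List using (List; []; _∷_)
open import Data.List.NonEmpty.Base as List⁺ using (List⁺; _∷_)
open import Data.List.Relation.Unary.Unique.Propositional using (Unique)
open import Data.List.Relation.Unary.All as ListAll using ([]; _∷_)
open import Data.List.Relation.Unary.AllPairs using ([]; _∷_)
open import Data.Nat.Base as ℕ using (ℕ; zero; suc; _≤_; _<_; z≤n; s≤s)
open import Data.Nat.DivMod using (m≡m%n+[m/n]*n; m%n<n; m/n*n≤m)
open import Data.Nat.Properties as ℕ using (m*n≢0; ≤-refl; ≤-trans; ≤-reflexive)
open import Data.Nat.Tactic.RingSolver using (solve-∀)
open import Data.Product.Base using (Σ-syntax; ∃-syntax; _×_; _,_; proj₁; proj₂)
open import Data.Rational.Base as ℚ using (ℚ; 1ℚ; ↥_; ↧_; ↧ₙ_; toℚᵘ)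
import Data.Rational.Properties as ℚ
open import Data.Rational.Unnormalised.Base as ℚᵘ using (mkℚᵘ; *≡*; *<*)
import Data.Rational.Unnormalised.Properties as ℚᵘ
open import Data.Sum.Base using (_⊎_; inj₁; inj₂)
open import Data.Unit.Base using (⊤; tt)
open import Data.Vec.Base as Vec using (Vec; []; _∷_; zipWith; replicate; head; tail; lookup; tabulate)
open import Data.Vec.Relation.Unary.All as VecAll using ([]; _∷_)
open import Function.Base using (_∘_; id)
open import Relation.Binary.PropositionalEquality as ≡ using (_≢_; refl; sym; trans; cong; cong₂; subst)
open import Relation.Binary.PropositionalEquality.Core using (_≡_)
open import Relation.Nullary using (¬_; Dec; yes; no; contradiction; recompute)
open import Relation.Nullary.Decidable using (_×-dec_; ¬?)

-- An edge label takes n^(2 m) values, as it carries one index for the factor at each of its two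
-- ends, and the d copies of T^⊗m account for d m factors. A bag of E edges thus costs n^(2 m E) up
-- to a constant, which is the origin of (2 / d) E. The number E = h g + h + g counts the edges of
-- K_d between classes of sizes h, g and 1. It arises on both sides: the middle bag of the path
-- consists of the edges between the earlier vertices, the current one and the later ones, and among
-- the partitions without a heavy class this one has the fewest edges between classes. Forming a
-- vertex takes n^m terms for each of n^(2 m (d - 1)) label vectors, which is at most n^(2 m E) as
-- soon as d ≤ E; this holds from d = 3 on and fails for d = 2, where E = 1. No general passage from
-- tree decompositions to circuits is made: the contraction follows the order of the path directly,
-- and only the number E links the two halves of the proof.

-- A cost calculus for arithmetic circuits.

module Circuits {c ℓ₁ ℓ₂ : Level} (𝔽 : HeytingField c ℓ₁ ℓ₂) (V : Set) where

  open import Data.Nat.Base using (_+_; _*_; _^_)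

  private
    module 𝔽 = HeytingField 𝔽
    module R = CommutativeRing (polyRing 𝔽 V)
    P = Poly 𝔽 V

  private variable
    m n k s t : ℕ
    C D E : Circuit 𝔽 V n
    p q : P
    I J : Set

  record Has {n : ℕ} (C : Circuit 𝔽 V n) {I : Set} (f : I → P) : Set (c ⊔ ℓ₁) where
    constructor has
    field at : ∀ i → Computes 𝔽 C (f i)
  open Has public

  infix 4 _⊑_
  record _⊑_ {m n : ℕ} (C : Circuit 𝔽 V m) (D : Circuit 𝔽 V n) : Set (c ⊔ ℓ₁) where
    constructor ext
    field keep : ∀ {p} → Computes 𝔽 C p → Computes 𝔽 D p
  open _⊑_ public

  ⊑-refl : C ⊑ C
  ⊑-refl = ext id

  ⊑-trans : C ⊑ D → D ⊑ E → C ⊑ E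
  ⊑-trans C⊑D D⊑E = ext λ x → keep D⊑E (keep C⊑D x)

  ⊑-▷ : {x : Vertex 𝔽 V n} {C : Circuit 𝔽 V n} → C ⊑ C ▷ x
  ⊑-▷ = ext λ (u , e) → suc u , e

  Has-⊑ : {f : I → P} → C ⊑ D → Has C f → Has D f
  Has-⊑ C⊑D h = has λ i → keep C⊑D (at h i)

  -- Quantifying over all D above C makes costs survive the extension of C, so that
  -- computations can be sequenced.
  record Cost {n : ℕ} (C : Circuit 𝔽 V n) (s : ℕ) {I : Set} (f : I → P) : Set (c ⊔ ℓ₁) where
    constructor cost
    field extend : ∀ {m} (D : Circuit 𝔽 V m) → C ⊑ D →
                   ∃[ n ] Σ[ E ∈ Circuit 𝔽 V n ] D ⊑ E × size 𝔽 E ≤ size 𝔽 D + s × Has E f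
  open Cost public

  Cost₁ : {n : ℕ} → Circuit 𝔽 V n → ℕ → P → Set (c ⊔ ℓ₁)
  Cost₁ C s p = Cost C s {⊤} (λ _ → p)

  known : {f : I → P} → Has C f → Cost C 0 f
  known h = cost λ D C⊑D → _ , D , ⊑-refl , ℕ.m≤m+n _ 0 , Has-⊑ C⊑D h

  Cost-mono : {f : I → P} → s ≤ t → Cost C s f → Cost C t f
  Cost-mono s≤t h = cost λ D C⊑D → let _ , E , D⊑E , z , e = extend h D C⊑D in
    _ , E , D⊑E , ≤-trans z (ℕ.+-monoʳ-≤ _ s≤t) , e

  Cost-map : {f : I → P} {g : J → P} →
    (∀ {m} {D : Circuit 𝔽 V m} → Has D f → Has D g) → Cost C s f → Cost C s g
  Cost-map r h = cost λ D C⊑D → let _ , E , D⊑E , z , e = extend h D C⊑D in _ , E , D⊑E , z , r e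

  Cost-resp : p R.≈ q → Cost₁ C s p → Cost₁ C s q
  Cost-resp p≈q = Cost-map λ h → has λ i → let u , e = at h i in u , R.trans e p≈q

  Cost-⊑ : {f : I → P} → C ⊑ D → Cost C s f → Cost D s f
  Cost-⊑ C⊑D h = cost λ E D⊑E → extend h E (⊑-trans C⊑D D⊑E)

  infixl 1 _>>=ᶜ_
  _>>=ᶜ_ : {f : I → P} {g : J → P} → Cost C s f →
    (∀ {m} {D : Circuit 𝔽 V m} → C ⊑ D → Has D f → Cost D t g) → Cost C (s + t) g
  _>>=ᶜ_ {s = s} {t = t} h k = cost λ D C⊑D →
    let _ , E , D⊑E , z , e   = extend h D C⊑D
        _ , F , E⊑F , z′ , e′ = extend (k (⊑-trans C⊑D D⊑E) e) E ⊑-refl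
    in _ , F , ⊑-trans D⊑E E⊑F ,
       ≤-trans z′ (≤-trans (ℕ.+-monoˡ-≤ t z) (≤-reflexive (ℕ.+-assoc _ s t))) , e′

  Cost-con : ∀ a → Cost₁ C 0 (con a)
  Cost-con a = cost λ D _ → _ , D ▷ input (inj₁ a) , ⊑-▷ , ≤-refl , has λ _ → zero , R.refl

  Cost-var : ∀ x → Cost₁ C 0 (var x)
  Cost-var x = cost λ D _ → _ , D ▷ input (inj₂ x) , ⊑-▷ , ≤-refl , has λ _ → zero , R.refl

  opᴾ : Op 𝔽 → P → P → P
  opᴾ add = R._+_
  opᴾ mul = R._*_

  -- The first operand is copied to a new vertex, since a gate may not have two
  -- wires from the same vertex.
  Cost-gate : ∀ o → Has C {⊤} (λ _ → p) → Has C {⊤} (λ _ → q) → Cost₁ C 3 (opᴾ o p q)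
  Cost-gate {p = p} {q = q} o hp hq = cost λ D C⊑D →
    let u , eu = keep C⊑D (at hp tt)
        v , ev = keep C⊑D (at hq tt)
    in _ , D ▷ copy u ▷ gate o (wires v) wires-unique , ⊑-trans ⊑-▷ ⊑-▷ , ≤-reflexive (ℕ.+-assoc _ 1 2) ,
       has λ _ → zero , correct o {D} {u} {v} eu ev
    where
    copy : Fin n → Vertex 𝔽 V n
    copy u = gate add ((𝔽.1# , u) ∷ []) ([] ∷ [])
    wires : Fin n → List⁺ (𝔽.Carrier × Fin (suc n))
    wires v = (𝔽.1# , zero) ∷ (𝔽.1# , suc v) ∷ []
    wires-unique : {v : Fin n} → Unique (List.map proj₂ (List⁺.toList (wires v)))
    wires-unique = ((λ ()) ∷ []) ∷ [] ∷ []
    copied : {D : Circuit 𝔽 V n} {u : Fin n} → value 𝔽 D u R.≈ p →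
      R.1# R.* value 𝔽 (D ▷ copy u) zero R.≈ p
    copied eu = R.trans (R.*-identityˡ _) (R.trans (R.+-identityʳ _) (R.trans (R.*-identityˡ _) eu))
    correct : ∀ o {D : Circuit 𝔽 V n} {u v : Fin n} → value 𝔽 D u R.≈ p → value 𝔽 D v R.≈ q →
      value 𝔽 (D ▷ copy u ▷ gate o (wires v) wires-unique) zero R.≈ opᴾ o p q
    correct add {D} eu ev = R.+-cong (copied {D = D} eu) (R.trans (R.+-identityʳ _) (R.trans (R.*-identityˡ _) ev))
    correct mul {D} eu ev = R.*-cong (copied {D = D} eu) (R.trans (R.*-identityʳ _) (R.trans (R.*-identityˡ _) ev))

  Cost-op : ∀ o → Cost₁ C s p → Cost₁ C t q → Cost₁ C (s + t + 3) (opᴾ o p q)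
  Cost-op {s = s} {t = t} o hp hq = Cost-mono (≤-reflexive (≡.sym (ℕ.+-assoc s t 3)))
    (hp >>=ᶜ λ C⊑D ep → Cost-⊑ C⊑D hq >>=ᶜ λ D⊑E eq → Cost-gate o (Has-⊑ D⊑E ep) eq)

  Cost-+ : Cost₁ C s p → Cost₁ C t q → Cost₁ C (s + t + 3) (p R.+ q)
  Cost-+ = Cost-op add

  Cost-* : Cost₁ C s p → Cost₁ C t q → Cost₁ C (s + t + 3) (p R.* q)
  Cost-* = Cost-op mul

  -- Finiteness in the only form needed here, which is closed under Vec without
  -- enumerating vectors.
  record Size (I : Set) (n : ℕ) : Set (Level.suc Level.zero ⊔ c ⊔ ℓ₁) where
    constructor mkSize
    field each : ∀ {J : Set} {m s} {C : Circuit 𝔽 V m} {f : I → J → P} →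
                 (∀ i → Cost C s (f i)) → Cost C (n * s) {I × J} (λ (i , j) → f i j)
  open Size public

  Cost-all : {f : I → P} → Size I n → (∀ i → Cost₁ C s (f i)) → Cost C (n * s) f
  Cost-all sz h = Cost-map (λ e → has λ i → at e (i , tt)) (each sz h)

  Size-Fin : Size (Fin k) k
  Size-Fin {zero}  = mkSize λ h → known (has λ ())
  Size-Fin {suc k} = mkSize λ {_} {_} {s} h → Cost-mono (≤-reflexive (≡.cong (s +_) (ℕ.+-identityʳ (k * s))))
    (h zero >>=ᶜ λ C⊑D e₀ → each (Size-Fin {k}) (λ i → Cost-⊑ C⊑D (h (suc i))) >>=ᶜ λ D⊑E e →
      known (has λ { (zero , j) → at (Has-⊑ D⊑E e₀) j ; (suc i , j) → at e (i , j) }))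

  Size-Vec : Size I n → Size (Vec I k) (n ^ k)
  Size-Vec {k = zero} sz = mkSize λ h →
    Cost-mono (≤-reflexive (≡.sym (ℕ.+-identityʳ _))) (Cost-map (λ e → has λ { ([] , j) → at e j }) (h []))
  Size-Vec {n = n} {k = suc k} sz = mkSize λ {_} {_} {s} h → Cost-mono (≤-reflexive (≡.sym (ℕ.*-assoc n (n ^ k) s)))
    (Cost-map (λ e → has λ { (i ∷ v , j) → at e (i , v , j) })
      (each sz (λ i → each (Size-Vec {k = k} sz) (λ v → h (i ∷ v)))))

  Cost-sum : {f : Fin k → P} → (∀ i → Cost₁ C s (f i)) → Cost₁ C (k * (s + 3)) (sumᴾ 𝔽 f)
  Cost-sum {zero}  h = Cost-con 𝔽.0#
  Cost-sum {suc k} {s = s} h = Cost-mono (≤-reflexive (eq s (k * (s + 3)))) (Cost-+ (h zero) (Cost-sum (λ i → h (suc i))))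
    where
    eq : ∀ a b → a + b + 3 ≡ a + 3 + b
    eq = solve-∀

  known₁ : {f : I → P} → Has C f → ∀ i → Cost₁ C 0 (f i)
  known₁ h i = known (has λ _ → at h i)

  -- There are n + n^2 + ... + n^k additions over the k levels. As n is nonzero, no level has more
  -- than n^k of them, so each term is charged for k additions.
  Cost-sumVec : ∀ k .{{_ : ℕ.NonZero n}} {f : Vec (Fin n) k → P} → (∀ v → Cost₁ C s (f v)) →
    Cost₁ C (n ^ k * (s + k * 3)) (sumVec 𝔽 k f)
  Cost-sumVec {s = s} zero h = Cost-mono (≤-reflexive (≡.sym (≡.trans (ℕ.+-identityʳ (s + 0)) (ℕ.+-identityʳ s)))) (h [])
  Cost-sumVec {n = n} {s = s} (suc k) {f} h = Cost-mono bound (Cost-sum λ i → Cost-sumVec k (λ v → h (i ∷ v)))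
    where
    open ℕ.≤-Reasoning
    N = n ^ k
    eq : ∀ a b s k → a * (b * (s + k * 3) + b * 3) ≡ (a * b) * (s + (3 + k * 3))
    eq = solve-∀
    bound : n * (N * (s + k * 3) + 3) ≤ n ^ suc k * (s + suc k * 3)
    bound = begin
      n * (N * (s + k * 3) + 3)     ≤⟨ ℕ.*-monoʳ-≤ n (ℕ.+-monoʳ-≤ (N * (s + k * 3)) (ℕ.*-monoˡ-≤ 3 (ℕ.m^n>0 n k))) ⟩
      n * (N * (s + k * 3) + N * 3) ≡⟨ eq n N s k ⟩
      n * N * (s + (3 + k * 3))     ∎

module _ {a b} {A : Set a} {B : Set b} where
  zipWith-const : ∀ {n} (as : Vec A n) (bs : Vec B n) → zipWith (λ x _ → x) as bs ≡ as
  zipWith-const []       []       = refl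
  zipWith-const (x ∷ as) (_ ∷ bs) = cong (x ∷_) (zipWith-const as bs)

  map-zipWith-proj₂ : ∀ {c} {C : Set c} {n} (g : C → B) (f : A → B → C) → (∀ x y → g (f x y) ≡ y) →
    (as : Vec A n) (bs : Vec B n) → Vec.map g (zipWith f as bs) ≡ bs
  map-zipWith-proj₂ g f gf []       []       = refl
  map-zipWith-proj₂ g f gf (x ∷ as) (y ∷ bs) = cong₂ _∷_ (gf x y) (map-zipWith-proj₂ g f gf as bs)

  map-zipWith-proj₁ : ∀ {c} {C : Set c} {n} (g : C → A) (f : A → B → C) → (∀ x y → g (f x y) ≡ x) →
    (as : Vec A n) (bs : Vec B n) → Vec.map g (zipWith f as bs) ≡ as
  map-zipWith-proj₁ g f gf []       []       = refl
  map-zipWith-proj₁ g f gf (x ∷ as) (y ∷ bs) = cong₂ _∷_ (gf x y) (map-zipWith-proj₁ g f gf as bs)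

quotient-combine : ∀ {m n} (i : Fin m) (j : Fin n) → quotient n (combine i j) ≡ i
quotient-combine i j = cong proj₁ (remQuot-combine i j)

remainder-combine : ∀ {m n} (i : Fin m) (j : Fin n) → remainder {m} n (combine i j) ≡ j
remainder-combine i j = cong proj₂ (remQuot-combine i j)

-- Algebra of iterated sums, Kronecker powers and tensor networks.

module Networks {c ℓ₁ ℓ₂ : Level} (𝔽 : HeytingField c ℓ₁ ℓ₂) (V : Set) where

  private
    module 𝔽 = HeytingField 𝔽
    module R = CommutativeRing (polyRing 𝔽 V)
    P = Poly 𝔽 V
  open CommutativeRing (polyRing 𝔽 V)
    using (_≈_; _+_; _*_; 0#; 1#; setoid)
  open import Relation.Binary.Reasoning.Setoid setoid
  open SumProperties R.semiring using (sum-cong-≋; sum-replicate-zero; ∑-distrib-+)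

  Σᶠ : ∀ {n} → (Fin n → P) → P
  Σᶠ = sumᴾ 𝔽

  Σᵛ : ∀ {n} d → (Vec (Fin n) d → P) → P
  Σᵛ = sumVec 𝔽

  Σᵐ : ∀ {n} r i → (Vec (Vec (Fin n) i) r → P) → P
  Σᵐ zero    i F = F []
  Σᵐ (suc r) i F = Σᵛ i λ b → Σᵐ r i λ bs → F (b ∷ bs)

  -- Iterated sums, multiplication by a constant and evaluation at an index are all additive, so
  -- that exchanging two sums and distributing a product over a sum become instances of the same
  -- swap lemmas.
  record IsAdditive {I : Set} (S : (I → P) → P) : Set (c ⊔ ℓ₁) where
    field
      S-cong : ∀ {f g} → (∀ i → f i ≈ g i) → S f ≈ S g
      S-0    : S (λ _ → 0#) ≈ 0#
      S-+    : ∀ f g → S (λ i → f i + g i) ≈ S f + S g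
  open IsAdditive

  Σᶠ-additive : ∀ {n} → IsAdditive (Σᶠ {n})
  Σᶠ-additive {n} = record { S-cong = sum-cong-≋ ; S-0 = sum-replicate-zero n ; S-+ = ∑-distrib-+ }

  nested-additive : {I J K : Set} {S : (I → P) → P} {T : (J → P) → P} → IsAdditive S → IsAdditive T →
    (g : I → J → K) → IsAdditive (λ f → S λ i → T λ j → f (g i j))
  nested-additive S T g = record
    { S-cong = λ f≈g → S-cong S λ i → S-cong T λ j → f≈g (g i j)
    ; S-0    = R.trans (S-cong S λ i → S-0 T) (S-0 S)
    ; S-+    = λ _ _ → R.trans (S-cong S λ i → S-+ T _ _) (S-+ S _ _)
    }

  single-additive : {I : Set} (i : I) → IsAdditive (λ f → f i)
  single-additive i = record { S-cong = λ f≈g → f≈g i ; S-0 = R.refl ; S-+ = λ _ _ → R.refl }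

  Σᵛ-additive : ∀ {n} d → IsAdditive (Σᵛ {n} d)
  Σᵛ-additive     zero    = single-additive []
  Σᵛ-additive {n} (suc d) = nested-additive (Σᶠ-additive {n}) (Σᵛ-additive d) _∷_

  Σᵐ-additive : ∀ {n} r i → IsAdditive (Σᵐ {n} r i)
  Σᵐ-additive zero    i = single-additive []
  Σᵐ-additive (suc r) i = nested-additive (Σᵛ-additive i) (Σᵐ-additive r i) _∷_

  Σᶠ-cong : ∀ {n} {f g : Fin n → P} → (∀ i → f i ≈ g i) → Σᶠ f ≈ Σᶠ g
  Σᶠ-cong = S-cong Σᶠ-additive

  Σᵛ-cong : ∀ {n} d {f g : Vec (Fin n) d → P} → (∀ i → f i ≈ g i) → Σᵛ d f ≈ Σᵛ d g
  Σᵛ-cong d = S-cong (Σᵛ-additive d)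

  Σᵐ-cong : ∀ {n} r i {f g : Vec (Vec (Fin n) i) r → P} → (∀ i → f i ≈ g i) → Σᵐ r i f ≈ Σᵐ r i g
  Σᵐ-cong r i = S-cong (Σᵐ-additive r i)

  *ˡ-additive : ∀ x → IsAdditive {⊤} (λ f → x * f tt)
  *ˡ-additive x = record { S-cong = λ f≈g → R.*-congˡ (f≈g tt) ; S-0 = R.zeroʳ x ; S-+ = λ _ _ → R.distribˡ x _ _ }

  *ʳ-additive : ∀ x → IsAdditive {⊤} (λ f → f tt * x)
  *ʳ-additive x = record { S-cong = λ f≈g → R.*-congʳ (f≈g tt) ; S-0 = R.zeroˡ x ; S-+ = λ _ _ → R.distribʳ x _ _ }

  module _ {I : Set} {S : (I → P) → P} (add : IsAdditive S) where

    Σᶠ-swap : ∀ {n} (f : Fin n → I → P) → Σᶠ (λ v → S (f v)) ≈ S (λ i → Σᶠ λ v → f v i)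
    Σᶠ-swap {zero}  f = R.sym (S-0 add)
    Σᶠ-swap {suc n} f = R.trans (R.+-congˡ (Σᶠ-swap (f ∘ suc))) (R.sym (S-+ add _ _))

    Σᵛ-swap : ∀ {n} d (f : Vec (Fin n) d → I → P) → Σᵛ d (λ v → S (f v)) ≈ S (λ i → Σᵛ d λ v → f v i)
    Σᵛ-swap zero    f = R.refl
    Σᵛ-swap {n} (suc d) f = R.trans (Σᶠ-cong {n} λ x → Σᵛ-swap d _) (Σᶠ-swap {n} _)

    Σᵐ-swap : ∀ {n} r i (f : Vec (Vec (Fin n) i) r → I → P) → Σᵐ r i (λ v → S (f v)) ≈ S (λ j → Σᵐ r i λ v → f v j)
    Σᵐ-swap zero    i f = R.refl
    Σᵐ-swap (suc r) i f = R.trans (Σᵛ-cong i λ x → Σᵐ-swap r i _) (Σᵛ-swap i _)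

  *-distribʳ-Σᶠ : ∀ {n} x (f : Fin n → P) → Σᶠ f * x ≈ Σᶠ (λ v → f v * x)
  *-distribʳ-Σᶠ x f = R.sym (Σᶠ-swap (*ʳ-additive x) (λ v _ → f v))

  *-distribˡ-Σᵛ : ∀ {n} d x (f : Vec (Fin n) d → P) → x * Σᵛ d f ≈ Σᵛ d (λ v → x * f v)
  *-distribˡ-Σᵛ d x f = R.sym (Σᵛ-swap (*ˡ-additive x) d (λ v _ → f v))

  *-distribʳ-Σᵛ : ∀ {n} d x (f : Vec (Fin n) d → P) → Σᵛ d f * x ≈ Σᵛ d (λ v → f v * x)
  *-distribʳ-Σᵛ d x f = R.sym (Σᵛ-swap (*ʳ-additive x) d (λ v _ → f v))

  *-left-comm : ∀ x y z → x * (y * z) ≈ y * (x * z)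
  *-left-comm x y z = R.trans (R.sym (R.*-assoc x y z)) (R.trans (R.*-congʳ (R.*-comm x y)) (R.*-assoc y x z))

  Σᶠ-++ : ∀ m {n} (f : Fin (m ℕ.+ n) → P) → Σᶠ f ≈ Σᶠ (λ i → f (i ↑ˡ n)) + Σᶠ (λ j → f (m ↑ʳ j))
  Σᶠ-++ zero    f = R.sym (R.+-identityˡ _)
  Σᶠ-++ (suc m) f = R.trans (R.+-congˡ (Σᶠ-++ m (f ∘ suc))) (R.sym (R.+-assoc _ _ _))

  Σᶠ-combine : ∀ m {n} (f : Fin (m ℕ.* n) → P) → Σᶠ f ≈ Σᶠ {m} λ i → Σᶠ {n} λ j → f (combine i j)
  Σᶠ-combine zero        f = R.refl
  Σᶠ-combine (suc m) {n} f = R.trans (Σᶠ-++ n f) (R.+-congˡ (Σᶠ-combine m (λ i → f (n ↑ʳ i))))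

  Σᵛ-combine : ∀ {m n} d (F : Vec (Fin (m ℕ.* n)) d → P) →
    Σᵛ d F ≈ Σᵛ {m} d λ a → Σᵛ {n} d λ b → F (zipWith combine a b)
  Σᵛ-combine zero F = R.refl
  Σᵛ-combine {m} {n} (suc d) F = begin
    Σᶠ (λ x → Σᵛ d λ v → F (x ∷ v))
      ≈⟨ Σᶠ-combine m {n} _ ⟩
    Σᶠ {m} (λ i → Σᶠ {n} λ j → Σᵛ d λ v → F (combine i j ∷ v))
      ≈⟨ Σᶠ-cong {m} (λ i → Σᶠ-cong {n} λ j → Σᵛ-combine d _) ⟩
    Σᶠ {m} (λ i → Σᶠ {n} λ j → Σᵛ d λ a → Σᵛ d λ b → F (combine i j ∷ zipWith combine a b))
      ≈⟨ Σᶠ-cong {m} (λ i → Σᶠ-swap (Σᵛ-additive d) {n} _) ⟩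
    Σᶠ {m} (λ i → Σᵛ d λ a → Σᶠ {n} λ j → Σᵛ d λ b → F (combine i j ∷ zipWith combine a b)) ∎

  Σᵛ-pairs : ∀ {m n} d (H : Vec (Fin m) d → Vec (Fin n) d → P) →
    Σᵛ {m ℕ.* n} d (λ l → H (Vec.map (quotient n) l) (Vec.map (remainder {m} n) l)) ≈ Σᵛ d λ a → Σᵛ d λ b → H a b
  Σᵛ-pairs d H = R.trans (Σᵛ-combine d _) (Σᵛ-cong d λ a → Σᵛ-cong d λ b → R.reflexive (cong₂ H
    (map-zipWith-proj₁ _ _ quotient-combine a b) (map-zipWith-proj₂ _ _ remainder-combine a b)))

  -- Peels off the first column of the index matrix although `Σᵐ` is nested by rows: that column
  -- holds the labels at the vertex that has just been processed.
  Σᵐ-columns : ∀ {n} r i (F : Vec (Vec (Fin n) (suc i)) r → P) →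
    Σᵐ r (suc i) F ≈ Σᵛ r λ col → Σᵐ r i λ bs → F (zipWith _∷_ col bs)
  Σᵐ-columns zero    i F = R.refl
  Σᵐ-columns {n} (suc r) i F = Σᶠ-cong {n} λ x → begin
    Σᵛ i (λ b → Σᵐ r (suc i) λ bs → F ((x ∷ b) ∷ bs))
      ≈⟨ Σᵛ-cong i (λ b → Σᵐ-columns r i _) ⟩
    Σᵛ i (λ b → Σᵛ r λ col → Σᵐ r i λ bs → F ((x ∷ b) ∷ zipWith _∷_ col bs))
      ≈⟨ Σᵛ-swap (Σᵛ-additive r) i _ ⟩
    Σᵛ r (λ col → Σᵛ i λ b → Σᵐ r i λ bs → F ((x ∷ b) ∷ zipWith _∷_ col bs)) ∎

  -- Kronecker products as sums over index matrices, and clique networks.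

  ∏ : ∀ {I : Set} {d} → Vec (I → P) d → Vec I d → P
  ∏ []       []       = 1#
  ∏ (y ∷ ys) (i ∷ is) = y i * ∏ ys is

  plug : ∀ {I : Set} {n} → (Vec I (suc n) → P) → I → Vec I n → P
  plug f x v = f (x ∷ v)

  -- The Kronecker product of the L factors `ts` evaluated at `ys`: a sum over d-by-L matrices in
  -- which factor l reads column l and mode v reads row v. The values of both are polynomials, so
  -- that partial sums can be substituted for them.
  Pow : ∀ {M d L} → Vec (Vec (Fin M) d → P) L → Vec (Vec (Fin M) L → P) d → P
  Pow         []       ys = ∏ ys (replicate _ [])
  Pow {d = d} (t ∷ ts) ys = Σᵛ d λ col → t col * Pow ts (zipWith plug ys col)

  -- Rows and columns of the index matrix enter symmetrically, hence a mode can be expanded in place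
  -- of a factor.
  Pow-row : ∀ {M d L} (ts : Vec (Vec (Fin M) (suc d) → P) L) (y : Vec (Fin M) L → P) (ys : Vec (Vec (Fin M) L → P) d) →
    Pow ts (y ∷ ys) ≈ Σᵛ L λ row → y row * Pow (zipWith plug ts row) ys
  Pow-row [] y ys = R.refl
  Pow-row {M} {d} {suc L} (t ∷ ts) y ys = Σᶠ-cong {M} λ x → begin
    Σᵛ d (λ col → t (x ∷ col) * Pow ts (plug y x ∷ zipWith plug ys col))
      ≈⟨ Σᵛ-cong d (λ col → R.trans (R.*-congˡ (Pow-row ts (plug y x) _)) (*-distribˡ-Σᵛ L _ _)) ⟩
    Σᵛ d (λ col → Σᵛ L λ row → t (x ∷ col) * (y (x ∷ row) * Pow (zipWith plug ts row) (zipWith plug ys col)))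
      ≈⟨ Σᵛ-swap (Σᵛ-additive L) d _ ⟩
    Σᵛ L (λ row → Σᵛ d λ col → t (x ∷ col) * (y (x ∷ row) * Pow (zipWith plug ts row) (zipWith plug ys col)))
      ≈⟨ Σᵛ-cong L (λ row → Σᵛ-cong d λ col → *-left-comm _ _ _) ⟩
    Σᵛ L (λ row → Σᵛ d λ col → y (x ∷ row) * (t (x ∷ col) * Pow (zipWith plug ts row) (zipWith plug ys col)))
      ≈⟨ Σᵛ-cong L (λ row → *-distribˡ-Σᵛ d _ _) ⟨
    Σᵛ L (λ row → y (x ∷ row) * Σᵛ d λ col → t (x ∷ col) * Pow (zipWith plug ts row) (zipWith plug ys col)) ∎

  -- The corner entry `x`, shared by the first column and the first row, occurs in no other factor
  -- or mode and is summed locally. For L = d this pairs factor v with mode v into vertex v of the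
  -- clique; the rest of the row and of the column become its edges.
  Pow-row-column : ∀ {M d L} (t : Vec (Fin M) (suc d) → P) (ts : Vec (Vec (Fin M) (suc d) → P) L)
    (y : Vec (Fin M) (suc L) → P) (ys : Vec (Vec (Fin M) (suc L) → P) d) →
    Pow (t ∷ ts) (y ∷ ys) ≈ Σᵛ L λ row → Σᵛ d λ col → (Σᶠ λ x → t (x ∷ col) * y (x ∷ row)) *
      Pow (zipWith plug ts row) (zipWith plug ys col)
  Pow-row-column {M} {d} {L} t ts y ys = begin
    Σᶠ (λ x → Σᵛ d λ col → t (x ∷ col) * Pow ts (plug y x ∷ zipWith plug ys col))
      ≈⟨ Σᶠ-cong {M} (λ x → Σᵛ-cong d λ col → R.trans (R.*-congˡ (Pow-row ts (plug y x) _)) (*-distribˡ-Σᵛ L _ _)) ⟩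
    Σᶠ (λ x → Σᵛ d λ col → Σᵛ L λ row → t (x ∷ col) * (y (x ∷ row) * Q row col))
      ≈⟨ Σᶠ-cong {M} (λ x → Σᵛ-swap (Σᵛ-additive L) d _) ⟩
    Σᶠ (λ x → Σᵛ L λ row → Σᵛ d λ col → t (x ∷ col) * (y (x ∷ row) * Q row col))
      ≈⟨ Σᶠ-swap (Σᵛ-additive L) {M} _ ⟩
    Σᵛ L (λ row → Σᶠ λ x → Σᵛ d λ col → t (x ∷ col) * (y (x ∷ row) * Q row col))
      ≈⟨ Σᵛ-cong L (λ row → Σᶠ-swap (Σᵛ-additive d) {M} _) ⟩
    Σᵛ L (λ row → Σᵛ d λ col → Σᶠ λ x → t (x ∷ col) * (y (x ∷ row) * Q row col))
      ≈⟨ Σᵛ-cong L (λ row → Σᵛ-cong d λ col → R.trans (Σᶠ-cong {M} λ x → R.sym (R.*-assoc _ _ _)) (R.sym (*-distribʳ-Σᶠ {M} _ _))) ⟩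
    Σᵛ L (λ row → Σᵛ d λ col → (Σᶠ λ x → t (x ∷ col) * y (x ∷ row)) * Q row col) ∎
    where
    Q : Vec (Fin _) L → Vec (Fin _) d → P
    Q row col = Pow (zipWith plug ts row) (zipWith plug ys col)

  -- The vertices of a clique, i of which have been processed already; the r remaining
  -- ones carry polynomials that depend on the labels of the incident edges.
  data Net (N i : ℕ) : ℕ → Set c where
    []  : Net N i 0
    _∷_ : ∀ {r} → (Vec (Fin N) i → Vec (Fin N) r → P) → Net N (suc i) r → Net N i (suc r)

  -- The open labels `bs` belong to the edges from processed to remaining vertices; the sum runs
  -- over the labels of the edges among the remaining ones.
  Z : ∀ {N i r} → Net N i r → Vec (Vec (Fin N) i) r → P
  Z []                 []       = 1#
  Z (_∷_ {r = r} A As) (b ∷ bs) = Σᵛ r λ row → A b row * Z As (zipWith _∷_ row bs)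

  -- Processing a vertex closes its i edges to earlier vertices, labelled by `b`, and opens its r
  -- edges to later ones, the heads of `cs`. With all of `cs`, (i + 1) r + i labels are involved.
  absorb : ∀ {N i r} → (Vec (Fin N) i → Vec (Fin N) r → P) → (Vec (Vec (Fin N) i) (suc r) → P) → Vec (Vec (Fin N) (suc i)) r → P
  absorb {i = i} A W cs = Σᵛ i λ b → W (b ∷ Vec.map tail cs) * A b (Vec.map head cs)

  contract : ∀ {N i r} → Net N i r → (Vec (Vec (Fin N) i) r → P) → P
  contract []       W = W []
  contract (A ∷ As) W = contract As (absorb A W)

  -- The pairing of W with the rest of the network is invariant: `absorb` is adjoint to one
  -- unfolding of `Z`, and both sides sum over the same `b`, `row` and `bs` in different orders.
  contract-correct : ∀ {N i r} (As : Net N i r) (W : Vec (Vec (Fin N) i) r → P) →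
    contract As W ≈ Σᵐ r i λ bs → W bs * Z As bs
  contract-correct [] W = R.sym (R.*-identityʳ _)
  contract-correct {i = i} (_∷_ {r = r} A As) W = begin
    contract As (absorb A W)
      ≈⟨ contract-correct As _ ⟩
    Σᵐ r (suc i) (λ cs → absorb A W cs * Z As cs)
      ≈⟨ Σᵐ-columns r i _ ⟩
    Σᵛ r (λ row → Σᵐ r i λ bs → absorb A W (zipWith _∷_ row bs) * Z As (zipWith _∷_ row bs))
      ≈⟨ Σᵛ-cong r (λ row → Σᵐ-cong r i λ bs → R.*-congʳ (Σᵛ-cong i λ b → R.reflexive (cong₂ (λ h t → W (b ∷ t) * A b h)
           (map-zipWith-proj₁ head _∷_ (λ _ _ → refl) row bs) (map-zipWith-proj₂ tail _∷_ (λ _ _ → refl) row bs)))) ⟩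
    Σᵛ r (λ row → Σᵐ r i λ bs → (Σᵛ i λ b → W (b ∷ bs) * A b row) * Z As (zipWith _∷_ row bs))
      ≈⟨ Σᵛ-cong r (λ row → Σᵐ-cong r i λ bs → R.trans (*-distribʳ-Σᵛ i _ _) (Σᵛ-cong i λ b → R.*-assoc _ _ _)) ⟩
    Σᵛ r (λ row → Σᵐ r i λ bs → Σᵛ i λ b → W (b ∷ bs) * (A b row * Z As (zipWith _∷_ row bs)))
      ≈⟨ Σᵛ-cong r (λ row → Σᵐ-swap (Σᵛ-additive i) r i _) ⟩
    Σᵛ r (λ row → Σᵛ i λ b → Σᵐ r i λ bs → W (b ∷ bs) * (A b row * Z As (zipWith _∷_ row bs)))
      ≈⟨ Σᵛ-swap (Σᵛ-additive i) r _ ⟩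
    Σᵛ i (λ b → Σᵛ r λ row → Σᵐ r i λ bs → W (b ∷ bs) * (A b row * Z As (zipWith _∷_ row bs)))
      ≈⟨ Σᵛ-cong i (λ b → Σᵛ-swap (Σᵐ-additive r i) r _) ⟩
    Σᵛ i (λ b → Σᵐ r i λ bs → Σᵛ r λ row → W (b ∷ bs) * (A b row * Z As (zipWith _∷_ row bs)))
      ≈⟨ Σᵛ-cong i (λ b → Σᵐ-cong r i λ bs → *-distribˡ-Σᵛ r _ _) ⟨
    Σᵛ i (λ b → Σᵐ r i λ bs → W (b ∷ bs) * (Σᵛ r λ row → A b row * Z As (zipWith _∷_ row bs))) ∎

  -- An edge label encodes two indices: that of the earlier vertex in the factor centred
  -- at the later one, and that of the later vertex in the factor centred at the earlier one.
  stage : ∀ {M i r} → (Vec (Fin (M ℕ.* M)) i → Vec (Fin M) (suc r) → P) → (Vec (Fin (M ℕ.* M)) i → Vec (Fin M) (suc r) → P) →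
    Vec (Fin (M ℕ.* M)) i → Vec (Fin (M ℕ.* M)) r → P
  stage {M} t y b l = Σᶠ λ x → t b (x ∷ Vec.map (remainder {M} M) l) * y b (x ∷ Vec.map (quotient M) l)

  -- Once a vertex is processed, the entry of a later factor or mode at it is no longer free but
  -- decoded from the label of the joining edge. The half `π` is the one that `stage` hands to the
  -- opposite partner: `quotient` for factors, `remainder` for modes.
  shift : ∀ {N M i r} → (Fin N → Fin M) → (Vec (Fin N) i → Vec (Fin M) (suc r) → P) → Vec (Fin N) (suc i) → Vec (Fin M) r → P
  shift π t b v = t (tail b) (π (head b) ∷ v)

  starNet : ∀ {M i r} → Vec (Vec (Fin (M ℕ.* M)) i → Vec (Fin M) r → P) r → Vec (Vec (Fin (M ℕ.* M)) i → Vec (Fin M) r → P) r →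
    Net (M ℕ.* M) i r
  starNet         []       []       = []
  starNet {M} (t ∷ ts) (y ∷ ys) = stage {M} t y ∷ starNet {M} (Vec.map (shift (quotient M)) ts) (Vec.map (shift (remainder {M} M)) ys)

  fix : ∀ {N M i r s} → Vec (Vec (Fin N) i → Vec (Fin M) r → P) s → Vec (Vec (Fin N) i) s → Vec (Vec (Fin M) r → P) s
  fix = zipWith (λ t b → t b)

  fix-shift : ∀ {N M i r s} (π : Fin N → Fin M) (ts : Vec (Vec (Fin N) i → Vec (Fin M) (suc r) → P) s) l bs →
    fix (Vec.map (shift π) ts) (zipWith _∷_ l bs) ≡ zipWith plug (fix ts bs) (Vec.map π l)
  fix-shift π []       []      []       = refl
  fix-shift π (t ∷ ts) (x ∷ l) (b ∷ bs) = cong (_ ∷_) (fix-shift π ts l bs)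

  -- Each unfolding of `Z` is one use of `Pow-row-column`: by `Σᵛ-pairs` a vector of labels is a row
  -- together with a column, and by `fix-shift` the later vertices receive exactly these entries.
  Z-starNet : ∀ {M i r} (ts ys : Vec (Vec (Fin (M ℕ.* M)) i → Vec (Fin M) r → P) r) bs →
    Z (starNet {M} ts ys) bs ≈ Pow (fix ts bs) (fix ys bs)
  Z-starNet [] [] [] = R.refl
  Z-starNet {M} {r = suc r} (t ∷ ts) (y ∷ ys) (b ∷ bs) = begin
    Σᵛ r (λ l → stage {M} t y b l * Z (starNet {M} (Vec.map (shift (quotient M)) ts) (Vec.map (shift (remainder {M} M)) ys)) (zipWith _∷_ l bs))
      ≈⟨ Σᵛ-cong r (λ l → R.*-congˡ (R.trans (Z-starNet {M} (Vec.map (shift (quotient M)) ts) (Vec.map (shift (remainder {M} M)) ys) (zipWith _∷_ l bs)) (R.reflexive (cong₂ Pow (fix-shift _ ts l bs) (fix-shift _ ys l bs))))) ⟩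
    Σᵛ r (λ l → stage {M} t y b l * Pow (zipWith plug (fix ts bs) (Vec.map (quotient M) l)) (zipWith plug (fix ys bs) (Vec.map (remainder {M} M) l)))
      ≈⟨ Σᵛ-pairs {M} {M} r (λ row col → (Σᶠ λ x → t b (x ∷ col) * y b (x ∷ row)) * Pow (zipWith plug (fix ts bs) row) (zipWith plug (fix ys bs) col)) ⟩
    Σᵛ r (λ row → Σᵛ r λ col → (Σᶠ λ x → t b (x ∷ col) * y b (x ∷ row)) * Pow (zipWith plug (fix ts bs) row) (zipWith plug (fix ys bs) col))
      ≈⟨ Pow-row-column (t b) (fix ts bs) (y b) (fix ys bs) ⟨
    Pow (t b ∷ fix ts bs) (y b ∷ fix ys bs) ∎

  -- Kronecker powers of `T` in block form.

  plugᶜ : ∀ m n → (Fin (m ℕ.* n) → P) → Fin m → Fin n → P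
  plugᶜ m n y a b = y (combine a b)

  eval : ∀ {d n} → Tensor 𝔽 d n → Vec (Fin n → P) d → P
  eval {d} t ys = Σᵛ d λ j → con (t j) * ∏ ys j

  ∏-combine : ∀ {d} m n (ys : Vec (Fin (m ℕ.* n) → P) d) a b → ∏ ys (zipWith combine a b) ≡ ∏ (zipWith (plugᶜ m n) ys a) b
  ∏-combine m n []       []      []      = refl
  ∏-combine m n (y ∷ ys) (i ∷ a) (j ∷ b) = cong (_ *_) (∏-combine m n ys a b)

  eval-⊗ : ∀ {d m n} (S : Tensor 𝔽 d m) (T : Tensor 𝔽 d n) ys →
    eval (_⊗_ 𝔽 S T) ys ≈ Σᵛ d λ a → con (S a) * eval T (zipWith (plugᶜ m n) ys a)
  eval-⊗ {d} {m} {n} S T ys = begin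
    Σᵛ d (λ j → con (_⊗_ 𝔽 S T j) * ∏ ys j)
      ≈⟨ Σᵛ-combine {m} {n} d _ ⟩
    Σᵛ d (λ a → Σᵛ d λ b → con (_⊗_ 𝔽 S T (zipWith combine a b)) * ∏ ys (zipWith combine a b))
      ≈⟨ Σᵛ-cong d (λ a → Σᵛ-cong d λ b → R.*-cong (coefficient a b) (R.reflexive (∏-combine m n ys a b))) ⟩
    Σᵛ d (λ a → Σᵛ d λ b → con (S a) * con (T b) * ∏ (zipWith (plugᶜ m n) ys a) b)
      ≈⟨ Σᵛ-cong d (λ a → R.trans (Σᵛ-cong d λ b → R.*-assoc _ _ _) (R.sym (*-distribˡ-Σᵛ d _ _))) ⟩
    Σᵛ d (λ a → con (S a) * eval T (zipWith (plugᶜ m n) ys a)) ∎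
    where
    coefficient : ∀ a b → con (_⊗_ 𝔽 S T (zipWith combine a b)) ≈ con (S a) * con (T b)
    coefficient a b = R.trans (R.reflexive (cong₂ (λ x y → con (S x 𝔽.* T y))
      (map-zipWith-proj₁ _ combine quotient-combine a b) (map-zipWith-proj₂ _ combine remainder-combine a b)))
      (con-* _ _)

  -- Concatenation of the digits of an index of T^⊗m with those of an index of T^⊗k.
  concat : ∀ n m k → Fin (n ℕ.^ m) → Fin (n ℕ.^ k) → Fin (n ℕ.^ (m ℕ.+ k))
  concat n zero   k _ j = j
  concat n (suc m) k i j = combine {n} (quotient {n} (n ℕ.^ m) i) (concat n m k (remainder {n} (n ℕ.^ m) i) j)

  prefix : ∀ n m k → (Fin (n ℕ.^ (m ℕ.+ k)) → P) → Fin (n ℕ.^ m) → Fin (n ℕ.^ k) → P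
  prefix n m k y a b = y (concat n m k a b)

  prefix-combine : ∀ {d} n m k (ys : Vec (Fin (n ℕ.^ (suc m ℕ.+ k)) → P) d) (a : Vec (Fin n) d) b →
    zipWith (prefix n (suc m) k) ys (zipWith combine a b) ≡ zipWith (prefix n m k) (zipWith (plugᶜ n (n ℕ.^ (m ℕ.+ k))) ys a) b
  prefix-combine n m k []       []      []      = refl
  prefix-combine n m k (y ∷ ys) (i ∷ a) (j ∷ b) = cong₂ _∷_
    (cong₂ (λ p q c → y (combine {n} p (concat n m k q c))) (quotient-combine i j) (remainder-combine i j))
    (prefix-combine n m k ys a b)

  Σᵛ-one : ∀ d (F : Vec (Fin 1) d → P) p → (∀ v → F v ≈ p) → Σᵛ d F ≈ p
  Σᵛ-one zero    F p h = h []
  Σᵛ-one (suc d) F p h = R.trans (R.+-identityʳ _) (Σᵛ-one d _ p λ v → h (zero ∷ v))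

  -- `concat` stands in for `combine` because n^(m + k) is not definitionally n^m times n^k; no
  -- index has to be transported along the law of exponents.
  eval-^-+ : ∀ {d n} (T : Tensor 𝔽 d n) m k ys → eval (_^⊗_ 𝔽 T (m ℕ.+ k)) ys ≈
    Σᵛ d λ a → con (_^⊗_ 𝔽 T m a) * eval (_^⊗_ 𝔽 T k) (zipWith (prefix n m k) ys a)
  eval-^-+ {d} {n} T zero k ys = R.sym (Σᵛ-one d _ _ λ a → R.trans (R.*-identityˡ _)
    (R.reflexive (cong (eval (_^⊗_ 𝔽 T k)) (zipWith-const ys a))))
  eval-^-+ {d} {n} T (suc m) k ys = begin
    eval (_^⊗_ 𝔽 T (suc m ℕ.+ k)) ys
      ≈⟨ eval-⊗ T (_^⊗_ 𝔽 T (m ℕ.+ k)) ys ⟩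
    Σᵛ d (λ a → con (T a) * eval (_^⊗_ 𝔽 T (m ℕ.+ k)) (zipWith (plugᶜ n _) ys a))
      ≈⟨ Σᵛ-cong d (λ a → R.trans (R.*-congˡ (eval-^-+ T m k _)) (*-distribˡ-Σᵛ d _ _)) ⟩
    Σᵛ d (λ a → Σᵛ d λ b → con (T a) * (con (_^⊗_ 𝔽 T m b) * eval (_^⊗_ 𝔽 T k) (zipWith (prefix n m k) (zipWith (plugᶜ n (n ℕ.^ (m ℕ.+ k))) ys a) b)))
      ≈⟨ Σᵛ-cong d (λ a → Σᵛ-cong d λ b → R.trans (R.sym (R.*-assoc _ _ _)) (R.*-cong (R.sym (con-* _ _))
           (R.reflexive (cong (eval (_^⊗_ 𝔽 T k)) (≡.sym (prefix-combine n m k ys a b)))))) ⟩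
    Σᵛ d (λ a → Σᵛ d λ b → con (T a 𝔽.* _^⊗_ 𝔽 T m b) * eval (_^⊗_ 𝔽 T k) (zipWith (prefix n (suc m) k) ys (zipWith combine a b)))
      ≈⟨ Σᵛ-cong d (λ a → Σᵛ-cong d λ b → R.*-congʳ (R.reflexive (cong₂ (λ x y → con (T x 𝔽.* _^⊗_ 𝔽 T m y))
           (map-zipWith-proj₁ _ combine quotient-combine a b) (map-zipWith-proj₂ _ combine remainder-combine a b)))) ⟨
    Σᵛ d (λ a → Σᵛ d λ b → con (_^⊗_ 𝔽 T (suc m) (zipWith combine a b)) * eval (_^⊗_ 𝔽 T k) (zipWith (prefix n (suc m) k) ys (zipWith combine a b)))
      ≈⟨ Σᵛ-combine {n} {n ℕ.^ m} d _ ⟨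
    Σᵛ d (λ a → con (_^⊗_ 𝔽 T (suc m) a) * eval (_^⊗_ 𝔽 T k) (zipWith (prefix n (suc m) k) ys a)) ∎

  blocks : ∀ n m L → Vec (Fin (n ℕ.^ m)) L → Fin (n ℕ.^ (L ℕ.* m))
  blocks n m zero    []       = zero
  blocks n m (suc L) (b ∷ bs) = concat n m (L ℕ.* m) b (blocks n m L bs)

  fromBlocks : ∀ n m L → (Fin (n ℕ.^ (L ℕ.* m)) → P) → Vec (Fin (n ℕ.^ m)) L → P
  fromBlocks n m L y bs = y (blocks n m L bs)

  fromBlocks-prefix : ∀ {d} n m L (ys : Vec (Fin (n ℕ.^ (suc L ℕ.* m)) → P) d) a →
    Vec.map (fromBlocks n m L) (zipWith (prefix n m (L ℕ.* m)) ys a) ≡ zipWith plug (Vec.map (fromBlocks n m (suc L)) ys) a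
  fromBlocks-prefix n m L []       []      = refl
  fromBlocks-prefix n m L (y ∷ ys) (b ∷ a) = cong (_ ∷_) (fromBlocks-prefix n m L ys a)

  ∏-one : ∀ {d} n m (ys : Vec (Fin (n ℕ.^ (0 ℕ.* m)) → P) d) v → ∏ ys v ≈ ∏ (Vec.map (fromBlocks n m 0) ys) (replicate d [])
  ∏-one n m []       []         = R.refl
  ∏-one n m (y ∷ ys) (zero ∷ v) = R.*-congˡ (∏-one n m ys v)

  eval-blocks : ∀ {d n} (T : Tensor 𝔽 d n) m L ys → eval (_^⊗_ 𝔽 T (L ℕ.* m)) ys ≈
    Pow (replicate L (λ a → con (_^⊗_ 𝔽 T m a))) (Vec.map (fromBlocks n m L) ys)
  eval-blocks {d} {n} T m zero    ys = Σᵛ-one d _ _ λ v → R.trans (R.*-identityˡ _) (∏-one n m ys v)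
  eval-blocks {d} {n} T m (suc L) ys = R.trans (eval-^-+ T m (L ℕ.* m) ys) (Σᵛ-cong d λ a → R.*-congˡ
    (R.trans (eval-blocks T m L _) (R.reflexive (cong (Pow (replicate L (λ a → con (_^⊗_ 𝔽 T m a)))) (fromBlocks-prefix n m L ys a)))))

  product-lookup : ∀ {I : Set} {d} (f : Fin d → I → P) (j : Vec I d) →
    productᴾ 𝔽 (λ i → f i (lookup j i)) ≡ ∏ (tabulate f) j
  product-lookup f []      = refl
  product-lookup f (i ∷ j) = cong (_ *_) (product-lookup (f ∘ suc) j)

-- Circuit size of contractions.

module Complexity {c ℓ₁ ℓ₂ : Level} (𝔽 : HeytingField c ℓ₁ ℓ₂) (V : Set) where

  open import Data.Nat.Base using (_+_; _*_; _^_)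
  open VecAll using (All)
  open import Data.Vec.Relation.Unary.All.Properties using (gmap)

  open Circuits 𝔽 V
  open Networks 𝔽 V

  private
    module 𝔽 = HeytingField 𝔽
    module R = CommutativeRing (polyRing 𝔽 V)
    P = Poly 𝔽 V

  private variable
    k s M N i r d L : ℕ
    C D : Circuit 𝔽 V k

  data NetCost {k : ℕ} (C : Circuit 𝔽 V k) (s : ℕ) {N : ℕ} : ∀ {i r} → Net N i r → Set (c ⊔ ℓ₁) where
    []  : NetCost C s {N} {i} []
    _∷_ : {A : Vec (Fin N) i → Vec (Fin N) r → P} {As : Net N (suc i) r} →
          (∀ b row → Cost₁ C s (A b row)) → NetCost C s As → NetCost C s (A ∷ As)

  NetCost-⊑ : {As : Net N i r} → C ⊑ D → NetCost C s As → NetCost D s As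
  NetCost-⊑ C⊑D []       = []
  NetCost-⊑ C⊑D (h ∷ hs) = (λ b row → Cost-⊑ C⊑D (h b row)) ∷ NetCost-⊑ C⊑D hs

  -- The values of `A` are tabulated before the main loop, so that the cost s of one value is not
  -- paid again for every label of the other open edges.
  absorb-cost : .{{_ : ℕ.NonZero N}} {A : Vec (Fin N) i → Vec (Fin N) r → P} {W : Vec (Vec (Fin N) i) (suc r) → P} →
    (∀ b row → Cost₁ C s (A b row)) → Has C W →
    Cost C (N ^ i * (N ^ r * s) + (N ^ suc i) ^ r * (N ^ i * (3 + i * 3))) (absorb A W)
  absorb-cost {N = N} {i = i} {r = r} hA hW = _>>=ᶜ_
    (each (Size-Vec {k = i} (Size-Fin)) λ b → Cost-all (Size-Vec {k = r} (Size-Fin)) (hA b))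
    λ C⊑D eA → Cost-all (Size-Vec {k = r} (Size-Vec (Size-Fin))) λ cs →
      Cost-sumVec i λ b → Cost-* (known₁ (Has-⊑ C⊑D hW) _) (known₁ eA (b , _))

  -- X and Y bound the tabulation and the loop of every stage. They are assumed for all splits into
  -- j vertices before and k after the current one, because the induction changes i and r and keeps
  -- only i + r.
  contract-cost : .{{_ : ℕ.NonZero N}} (As : Net N i r) {W : Vec (Vec (Fin N) i) r → P} {X Y : ℕ} →
    (∀ j k → suc (j + k) ≡ i + r → N ^ j * (N ^ k * s) ≤ X) →
    (∀ j k → suc (j + k) ≡ i + r → N ^ (suc j * k + j) ≤ Y) →
    NetCost C s As → Has C W → Cost₁ C (r * (X + Y * (3 + (i + r) * 3))) (contract As W)
  contract-cost [] hX hY [] hW = known₁ hW []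
  contract-cost {N = N} {i = i} {s = s} (_∷_ {r = r} A As) {X = X} {Y = Y} hX hY (h ∷ hs) hW = _>>=ᶜ_
    (Cost-mono stage≤ (absorb-cost h hW))
    (λ C⊑D e → Cost-mono (≤-reflexive (cong (λ d → r * (X + Y * (3 + d * 3))) (≡.sym eq)))
      (contract-cost As (λ j k p → hX j k (≡.trans p (≡.sym eq))) (λ j k p → hY j k (≡.trans p (≡.sym eq))) (NetCost-⊑ C⊑D hs) e))
    where
    open ℕ.≤-Reasoning
    eq : i + suc r ≡ suc i + r
    eq = ℕ.+-suc i r
    assemble : (N ^ suc i) ^ r * (N ^ i * (3 + i * 3)) ≡ N ^ (suc i * r + i) * (3 + i * 3)
    assemble = ≡.trans (≡.sym (ℕ.*-assoc ((N ^ suc i) ^ r) (N ^ i) _)) (cong (_* (3 + i * 3))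
      (≡.trans (cong (_* N ^ i) (ℕ.^-*-assoc N (suc i) r)) (≡.sym (ℕ.^-distribˡ-+-* N (suc i * r) i))))
    stage≤ : N ^ i * (N ^ r * s) + (N ^ suc i) ^ r * (N ^ i * (3 + i * 3)) ≤ X + Y * (3 + (i + suc r) * 3)
    stage≤ = begin
      N ^ i * (N ^ r * s) + (N ^ suc i) ^ r * (N ^ i * (3 + i * 3)) ≡⟨ cong (N ^ i * (N ^ r * s) +_) assemble ⟩
      N ^ i * (N ^ r * s) + N ^ (suc i * r + i) * (3 + i * 3)
        ≤⟨ ℕ.+-mono-≤ (hX i r (≡.sym eq)) (ℕ.*-mono-≤ (hY i r (≡.sym eq)) (ℕ.+-monoʳ-≤ 3 (ℕ.*-monoˡ-≤ 3 (ℕ.m≤m+n i (suc r))))) ⟩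
      X + Y * (3 + (i + suc r) * 3) ∎

  Free : {I : Set} {k : ℕ} → Circuit 𝔽 V k → (I → P) → Set (c ⊔ ℓ₁)
  Free C f = ∀ i → Cost₁ C 0 (f i)

  Free₂ : {I J : Set} {k : ℕ} → Circuit 𝔽 V k → (I → J → P) → Set (c ⊔ ℓ₁)
  Free₂ C f = ∀ i → Free C (f i)

  All-zipWith : ∀ {a b e p q} {A : Set a} {B : Set b} {E : Set e} {Q : A → Set p} {Q′ : B → Set q} {f : A → E → B} →
    (∀ {x} → Q x → ∀ y → Q′ (f x y)) → ∀ {n} {xs : Vec A n} (ys : Vec E n) → All Q xs → All Q′ (zipWith f xs ys)
  All-zipWith h []       []         = []
  All-zipWith h (y ∷ ys) (px ∷ pxs) = h px y ∷ All-zipWith h ys pxs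

  -- Each of the M terms takes three wires for its product and three for its addition.
  starNet-cost : {ts ys : Vec (Vec (Fin (M * M)) i → Vec (Fin M) r → P) r} →
    All (Free₂ C) ts → All (Free₂ C) ys → NetCost C (M * 6) (starNet {M = M} ts ys)
  starNet-cost {ts = []}     {ys = []}     []       []       = []
  starNet-cost {M = M} {ts = t ∷ ts} {ys = y ∷ ys} (ht ∷ hts) (hy ∷ hys) =
    (λ b row → Cost-sum {k = M} λ x → Cost-* (ht _ _) (hy _ _)) ∷
    starNet-cost (gmap (λ h b v → h _ _) hts) (gmap (λ h b v → h _ _) hys)

  fix-const : ∀ {r} {N s} (ts : Vec (Vec (Fin M) r → P) s) → fix {N = N} (Vec.map (λ t _ → t) ts) (replicate s []) ≡ ts
  fix-const []       = refl
  fix-const (t ∷ ts) = cong (t ∷_) (fix-const ts)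

  Σᵐ-0 : ∀ r (F : Vec (Vec (Fin N) 0) r → P) → Σᵐ r 0 F ≡ F (replicate r [])
  Σᵐ-0 zero    F = refl
  Σᵐ-0 (suc r) F = Σᵐ-0 r (F ∘ ([] ∷_))

  Pow-cost : .{{_ : ℕ.NonZero M}} {ts ys : Vec (Vec (Fin M) d → P) d} {X Y : ℕ} →
    (∀ j k → suc (j + k) ≡ d → (M * M) ^ j * ((M * M) ^ k * (M * 6)) ≤ X) →
    (∀ j k → suc (j + k) ≡ d → (M * M) ^ (suc j * k + j) ≤ Y) →
    All (Free C) ts → All (Free C) ys → Cost₁ C (d * (X + Y * (3 + d * 3))) (Pow ts ys)
  Pow-cost {M = M} {d = d} {C = C} {ts} {ys} hX hY hts hys = Cost-resp correct
    (_>>=ᶜ_ (Cost-map (λ e → has λ _ → at e tt) (Cost-con 𝔽.1#))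
      λ C⊑D h → contract-cost {{ℕ.m*n≢0 M M}} As hX hY (NetCost-⊑ C⊑D (starNet-cost (gmap (λ h _ → h) hts) (gmap (λ h _ → h) hys))) h)
    where
    ts′ = Vec.map (λ t (_ : Vec (Fin (M * M)) 0) → t) ts
    ys′ = Vec.map (λ t (_ : Vec (Fin (M * M)) 0) → t) ys
    As = starNet {M = M} ts′ ys′
    correct : contract As (λ _ → R.1#) R.≈ Pow ts ys
    correct = R.trans (contract-correct As _) (R.trans (R.reflexive (Σᵐ-0 d _)) (R.trans (R.*-identityˡ _)
      (R.trans (Z-starNet {M = M} ts′ ys′ (replicate d [])) (R.reflexive (cong₂ (Pow) (fix-const ts) (fix-const ys))))))

  Pow-linear : (ts : Vec (Vec (Fin M) (suc d) → P) L) (a : Fin k → P) (y : Fin k → Vec (Fin M) L → P) (ys : Vec (Vec (Fin M) L → P) d) →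
    Pow ts ((λ row → Σᶠ λ i → a i R.* y i row) ∷ ys) R.≈ Σᶠ λ i → a i R.* Pow ts (y i ∷ ys)
  Pow-linear {L = L} {k = k} ts a y ys = begin
    Pow ts ((λ row → Σᶠ λ i → a i R.* y i row) ∷ ys)
      ≈⟨ Pow-row ts _ ys ⟩
    Σᵛ L (λ row → (Σᶠ λ i → a i R.* y i row) R.* Q row)
      ≈⟨ Σᵛ-cong L (λ row → R.trans (*-distribʳ-Σᶠ {k} _ _) (Σᶠ-cong {k} λ i → R.*-assoc _ _ _)) ⟩
    Σᵛ L (λ row → Σᶠ λ i → a i R.* (y i row R.* Q row))
      ≈⟨ Σᵛ-swap (Σᶠ-additive {k}) L _ ⟩
    Σᶠ (λ i → Σᵛ L λ row → a i R.* (y i row R.* Q row))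
      ≈⟨ Σᶠ-cong {k} (λ i → R.trans (R.*-congˡ (Pow-row ts (y i) ys)) (*-distribˡ-Σᵛ L _ _)) ⟨
    Σᶠ (λ i → a i R.* Pow ts (y i ∷ ys)) ∎
    where
    open import Relation.Binary.Reasoning.Setoid R.setoid
    Q : Vec (Fin _) L → P
    Q row = Pow (zipWith plug ts row) ys

  -- Summing over the row index first costs only one vector-matrix product.
  matrix-step : (t : Vec (Fin M) 2 → P) (ts : Vec (Vec (Fin M) 2 → P) L) (x y : Vec (Fin M) (suc L) → P) →
    Pow (t ∷ ts) (x ∷ y ∷ []) R.≈
      Σᶠ λ j → Pow ts ((λ row → Σᶠ λ i → t (i ∷ j ∷ []) R.* x (i ∷ row)) ∷ plug y j ∷ [])
  matrix-step {M = M} t ts x y = R.trans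
    (Σᶠ-swap (Σᶠ-additive {M}) {M} (λ i j → t (i ∷ j ∷ []) R.* Pow ts (plug x i ∷ plug y j ∷ [])))
    (Σᶠ-cong {M} λ j → R.sym (Pow-linear ts (λ i → t (i ∷ j ∷ [])) (plug x) (plug y j ∷ [])))

  -- For each of the M values of the first index of `y`, the new vector takes M^L sums of M terms,
  -- and the recursion has one factor less; so a further factor raises the power of M by one only.
  -- Per factor, 6 pays for a term of the vector-matrix product and 3 for the sum over j.
  matrix-cost : .{{_ : ℕ.NonZero M}} {ts : Vec (Vec (Fin M) 2 → P) L} {x y : Vec (Fin M) L → P} →
    All (Free C) ts → Free C x → Free C y → Cost₁ C (M ^ suc L * (L * 9 + 6)) (Pow ts (x ∷ y ∷ []))
  matrix-cost {M = M} {ts = []} [] hx hy =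
    Cost-mono (ℕ.*-monoˡ-≤ 6 (ℕ.m^n>0 M 1)) (Cost-* (hx []) (Cost-* (hy []) (Cost-con 𝔽.1#)))
  matrix-cost {M = M} {L = suc L} {ts = t ∷ ts} {x} {y} (ht ∷ hts) hx hy =
    Cost-resp (R.sym (matrix-step t ts x y)) (Cost-mono bound (Cost-sum {k = M} λ j →
      Cost-all (Size-Vec (Size-Fin {M})) (λ row → Cost-sum {k = M} λ i → Cost-* (ht (i ∷ j ∷ [])) (hx (i ∷ row))) >>=ᶜ λ C⊑D hz →
      matrix-cost (VecAll.map (λ h i → Cost-⊑ C⊑D (h i)) hts) (known₁ hz) (λ row → Cost-⊑ C⊑D (hy (j ∷ row)))))
    where
    open ℕ.≤-Reasoning
    eq : ∀ M N L → M * (N * (M * 6) + M * N * (L * 9 + 6) + M * N * 3) ≡ M * (M * N) * (9 + L * 9 + 6)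
    eq = solve-∀
    bound : M * (M ^ L * (M * 6) + M ^ suc L * (L * 9 + 6) + 3) ≤ M ^ suc (suc L) * (suc L * 9 + 6)
    bound = begin
      M * (M ^ L * (M * 6) + M ^ suc L * (L * 9 + 6) + 3)
        ≤⟨ ℕ.*-monoʳ-≤ M (ℕ.+-monoʳ-≤ (M ^ L * (M * 6) + M ^ suc L * (L * 9 + 6)) (ℕ.*-monoˡ-≤ 3 (ℕ.m^n>0 M (suc L)))) ⟩
      M * (M ^ L * (M * 6) + M ^ suc L * (L * 9 + 6) + M ^ suc L * 3)
        ≡⟨ eq M (M ^ L) L ⟩
      M ^ suc (suc L) * (suc L * 9 + 6) ∎

  -- The r leftover factors are expanded term by term; their (n^r)^d coefficients are bounded in
  -- number once r stays below L.
  blocks-cost : ∀ {d n} .{{_ : ℕ.NonZero n}} (T : Tensor 𝔽 d n) r m L {S} {ys : Vec (Fin (n ^ (r + L * m)) → P) d} →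
    (∀ {zs} → All (Free C) zs → Cost₁ C S (Pow (replicate L (λ a → con (_^⊗_ 𝔽 T m a))) zs)) → All (Free C) ys →
    Cost₁ C ((n ^ r) ^ d * (0 + S + 3 + d * 3)) (eval (_^⊗_ 𝔽 T (r + L * m)) ys)
  blocks-cost {C = C} {d = d} {n} T r m L {S} {ys} h hys = Cost-resp (R.sym (eval-^-+ T r (L * m) ys))
    (Cost-sumVec d {{ℕ.m^n≢0 n r}} λ a → Cost-* (Cost-con _)
      (Cost-resp (R.sym (eval-blocks T m L _)) (h (gmap (λ f bs → f _) (All-zipWith {Q = Free C} {Q′ = Free C} (λ f b j → f _) a hys)))))

-- From circuit sizes to growth exponents.

module Growth {c ℓ₁ ℓ₂ : Level} (𝔽 : HeytingField c ℓ₁ ℓ₂) where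

  open import Data.Nat.Base using (_+_; _*_; _^_; _/_; _%_)
  open VecAll using (All)

  ^-distribʳ-* : ∀ k m n → (m * n) ^ k ≡ m ^ k * n ^ k
  ^-distribʳ-* zero    m n = refl
  ^-distribʳ-* (suc k) m n = ≡.trans (cong (m * n *_) (^-distribʳ-* k m n)) (eq m n (m ^ k) (n ^ k))
    where
    eq : ∀ a b c d → a * b * (c * d) ≡ a * c * (b * d)
    eq = solve-∀

  module _ {d n} .{{_ : ℕ.NonZero n}} (T : Tensor 𝔽 d n) (r m L : ℕ) where

    private
      V = TVar 𝔽 d (n ^ (r + L * m))
      module R = CommutativeRing (polyRing 𝔽 V)

    open Circuits 𝔽 V
    open Networks 𝔽 V
    open Complexity 𝔽 V

    power-cost : ∀ S → (∀ {zs} → All (Free ∅) zs → Cost₁ ∅ S (Pow (replicate L (λ a → con (_^⊗_ 𝔽 T m a))) zs)) →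
      C[_]≤_ 𝔽 (_^⊗_ 𝔽 T (r + L * m)) ((n ^ r) ^ d * (S + 3 + d * 3))
    power-cost S h =
      let _ , E , _ , size≤ , computes = extend (blocks-cost {C = ∅} T r m L h (tabulate-free id)) ∅ ⊑-refl
          u , e = at computes tt
      in _ , E ,
         (u , R.trans e (Σᵛ-cong d λ j → R.*-congˡ (R.reflexive (≡.sym (product-lookup (λ i x → var (i , x)) j))))) ,
         size≤
      where
      tabulate-free : ∀ {e} (f : Fin e → Fin d) → All (Free ∅) (tabulate λ v (j : Fin (n ^ (r + L * m))) → var (f v , j))
      tabulate-free {zero}  f = []
      tabulate-free {suc e} f = (λ j → Cost-var (f zero , j)) ∷ tabulate-free (f ∘ suc)

  -- Write β = a / b and k = r + L m with r < L. Then m e b ≤ m a L ≤ a k, and all that depends on r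
  -- is absorbed into the constant.
  growth : ∀ {d n} .{{_ : ℕ.NonZero n}} (T : Tensor 𝔽 d n) L .{{_ : ℕ.NonZero L}} e A (β : ℚ) → ℚ.NonNegative β →
    e * ↧ₙ β ≤ ∣ ↥ β ∣ * L →
    (∀ r m → C[_]≤_ 𝔽 (_^⊗_ 𝔽 T (r + L * m)) ((n ^ r) ^ d * (A * n ^ (m * e) + 3 + d * 3))) →
    IsGrowthExponent 𝔽 T β
  growth {d} {n} T L e A β β≥0 eb≤aL h = β≥0 , R , 0 , λ k _ →
    let r = k % L; m = k / L in
    _ , subst (λ k → C[_]≤_ 𝔽 (_^⊗_ 𝔽 T k) ((n ^ r) ^ d * (A * n ^ (m * e) + 3 + d * 3)))
          (≡.sym (≡.trans (m≡m%n+[m/n]*n k L) (cong (r +_) (ℕ.*-comm m L)))) (h r m) ,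
    bound k r m (m%n<n k L) (≤-trans (≤-reflexive (ℕ.*-comm L m)) (m/n*n≤m k L))
    where
    open ℕ.≤-Reasoning
    a = ∣ ↥ β ∣
    b = ↧ₙ β
    R = (n ^ L) ^ d * (A + 3 + d * 3)
    eq : ∀ A N d → A * N + N * 3 + N * (d * 3) ≡ (A + 3 + d * 3) * N
    eq = solve-∀
    eq′ : ∀ m e b → m * e * b ≡ m * (e * b)
    eq′ = solve-∀
    eq″ : ∀ m a L → m * (a * L) ≡ a * (L * m)
    eq″ = solve-∀
    s≤ : ∀ r m → r < L → (n ^ r) ^ d * (A * n ^ (m * e) + 3 + d * 3) ≤ R * n ^ (m * e)
    s≤ r m r<L = begin
      (n ^ r) ^ d * (A * N + 3 + d * 3)
        ≤⟨ ℕ.*-mono-≤ (ℕ.^-monoˡ-≤ d (ℕ.^-monoʳ-≤ n (ℕ.<⇒≤ r<L)))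
             (ℕ.+-mono-≤ (ℕ.+-monoʳ-≤ (A * N) (ℕ.*-monoˡ-≤ 3 1≤N)) (≤-trans (≤-reflexive (≡.sym (ℕ.*-identityˡ (d * 3)))) (ℕ.*-monoˡ-≤ (d * 3) 1≤N))) ⟩
      (n ^ L) ^ d * (A * N + N * 3 + N * (d * 3)) ≡⟨ cong ((n ^ L) ^ d *_) (eq A N d) ⟩
      (n ^ L) ^ d * ((A + 3 + d * 3) * N)         ≡⟨ ℕ.*-assoc ((n ^ L) ^ d) (A + 3 + d * 3) N ⟨
      R * N ∎
      where
      N = n ^ (m * e)
      1≤N : 1 ≤ N
      1≤N = ℕ.m^n>0 n (m * e)
    bound : ∀ k r m → r < L → L * m ≤ k →
      ((n ^ r) ^ d * (A * n ^ (m * e) + 3 + d * 3)) ^ b ≤ R ^ b * n ^ (a * k)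
    bound k r m r<L Lm≤k = begin
      ((n ^ r) ^ d * (A * n ^ (m * e) + 3 + d * 3)) ^ b ≤⟨ ℕ.^-monoˡ-≤ b (s≤ r m r<L) ⟩
      (R * n ^ (m * e)) ^ b      ≡⟨ ^-distribʳ-* b R (n ^ (m * e)) ⟩
      R ^ b * (n ^ (m * e)) ^ b  ≡⟨ cong (R ^ b *_) (≡.trans (ℕ.^-*-assoc n (m * e) b) (cong (n ^_) (eq′ m e b))) ⟩
      R ^ b * n ^ (m * (e * b))  ≤⟨ ℕ.*-monoʳ-≤ (R ^ b) (ℕ.^-monoʳ-≤ n (≤-trans (ℕ.*-monoʳ-≤ m eb≤aL)
                                      (≤-trans (≤-reflexive (eq″ m a L)) (ℕ.*-monoʳ-≤ a Lm≤k)))) ⟩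
      R ^ b * n ^ (a * k) ∎

  All-replicate : ∀ {a p} {A : Set a} {Q : A → Set p} {x} n → Q x → All Q (replicate n x)
  All-replicate zero    q = []
  All-replicate (suc n) q = q ∷ All-replicate n q

  growth-matrix : ∀ {n} .{{_ : ℕ.NonZero n}} (T : Tensor 𝔽 2 n) L .{{_ : ℕ.NonZero L}} (β : ℚ) → ℚ.NonNegative β →
    suc L * ↧ₙ β ≤ ∣ ↥ β ∣ * L → IsGrowthExponent 𝔽 T β
  growth-matrix {n} T L β β≥0 eb≤aL = growth T L (suc L) (L * 9 + 6) β β≥0 eb≤aL bound
    where
    bound : ∀ r m → C[_]≤_ 𝔽 (_^⊗_ 𝔽 T (r + L * m)) ((n ^ r) ^ 2 * ((L * 9 + 6) * n ^ (m * suc L) + 3 + 2 * 3))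
    bound r m = power-cost T r m L _ λ { {x ∷ y ∷ []} (hx ∷ hy ∷ []) →
      Cost-mono (≤-reflexive (≡.trans (ℕ.*-comm _ (L * 9 + 6)) (cong ((L * 9 + 6) *_) (ℕ.^-*-assoc n m (suc L)))))
        (matrix-cost {{ℕ.m^n≢0 n m}} (All-replicate L λ v → Cost-con _) hx hy) }
      where
      open Circuits 𝔽 (TVar 𝔽 2 (n ^ (r + L * m)))
      open Complexity 𝔽 (TVar 𝔽 2 (n ^ (r + L * m)))

  -- Two hypotheses for two costs: `d ≤ E` pays for tabulating the vertices, the bound on all splits
  -- j, k for contracting them.
  growth-star : ∀ {d n} .{{_ : ℕ.NonZero n}} (T : Tensor 𝔽 d n) .{{_ : ℕ.NonZero d}} E (β : ℚ) → ℚ.NonNegative β →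
    d ≤ E → (∀ j k → suc (j + k) ≡ d → suc j * k + j ≤ E) →
    2 * E * ↧ₙ β ≤ ∣ ↥ β ∣ * d → IsGrowthExponent 𝔽 T β
  growth-star {d} {n} T E β β≥0 d≤E bag≤E eb≤aL = growth T d (2 * E) (d * (6 + (3 + d * 3))) β β≥0 eb≤aL bound
    where
    open ℕ.≤-Reasoning
    collect : ∀ d N → d * (6 * N + N * (3 + d * 3)) ≡ d * (6 + (3 + d * 3)) * N
    collect = solve-∀
    square : ∀ m k → (n ^ m * n ^ m) ^ k ≡ n ^ (m * (2 * k))
    square m k = ≡.trans (cong (_^ k) (≡.sym (ℕ.^-distribˡ-+-* n m m))) (≡.trans (ℕ.^-*-assoc n (m + m) k) (cong (n ^_) (eq m k)))
      where
      eq : ∀ m k → (m + m) * k ≡ m * (2 * k)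
      eq = solve-∀
    bound₁ : ∀ m j k → suc (j + k) ≡ d → (n ^ m * n ^ m) ^ j * ((n ^ m * n ^ m) ^ k * (n ^ m * 6)) ≤ 6 * n ^ (m * (2 * E))
    bound₁ m j k refl = begin
      (n ^ m * n ^ m) ^ j * ((n ^ m * n ^ m) ^ k * (n ^ m * 6))
        ≡⟨ cong₂ (λ x y → x * (y * (n ^ m * 6))) (square m j) (square m k) ⟩
      n ^ (m * (2 * j)) * (n ^ (m * (2 * k)) * (n ^ m * 6))
        ≡⟨ eq (n ^ (m * (2 * j))) (n ^ (m * (2 * k))) (n ^ m) ⟩
      6 * (n ^ (m * (2 * j)) * n ^ (m * (2 * k)) * n ^ m)
        ≡⟨ cong (6 *_) (≡.trans (cong (_* n ^ m) (≡.sym (ℕ.^-distribˡ-+-* n (m * (2 * j)) (m * (2 * k)))))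
             (≡.sym (ℕ.^-distribˡ-+-* n (m * (2 * j) + m * (2 * k)) m))) ⟩
      6 * n ^ (m * (2 * j) + m * (2 * k) + m)
        ≤⟨ ℕ.*-monoʳ-≤ 6 (ℕ.^-monoʳ-≤ n (begin
             -- The exponent 2 (d - 1) + 1 is rounded up to 2 d, which `d ≤ E` can absorb.
             m * (2 * j) + m * (2 * k) + m ≤⟨ ℕ.m≤m+n _ m ⟩
             m * (2 * j) + m * (2 * k) + m + m ≡⟨ eq′ m j k ⟩
             m * (2 * suc (j + k))             ≤⟨ ℕ.*-monoʳ-≤ m (ℕ.*-monoʳ-≤ 2 d≤E) ⟩
             m * (2 * E) ∎)) ⟩
      6 * n ^ (m * (2 * E)) ∎
      where
      eq : ∀ a b c → a * (b * (c * 6)) ≡ 6 * (a * b * c)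
      eq = solve-∀
      eq′ : ∀ m j k → m * (2 * j) + m * (2 * k) + m + m ≡ m * (2 * suc (j + k))
      eq′ = solve-∀
    bound₂ : ∀ m j k → suc (j + k) ≡ d → (n ^ m * n ^ m) ^ (suc j * k + j) ≤ n ^ (m * (2 * E))
    bound₂ m j k p = ≤-trans (≤-reflexive (square m (suc j * k + j)))
      (ℕ.^-monoʳ-≤ n (ℕ.*-monoʳ-≤ m (ℕ.*-monoʳ-≤ 2 (bag≤E j k p))))
    bound : ∀ r m → C[_]≤_ 𝔽 (_^⊗_ 𝔽 T (r + d * m)) ((n ^ r) ^ d * (d * (6 + (3 + d * 3)) * n ^ (m * (2 * E)) + 3 + d * 3))
    bound r m = power-cost T r m d _ λ hzs → Cost-mono (≤-reflexive (collect d (n ^ (m * (2 * E)))))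
      (Pow-cost {{ℕ.m^n≢0 n m}} (bound₁ m) (bound₂ m) (All-replicate d λ v → Cost-con _) hzs)
      where
      open Circuits 𝔽 (TVar 𝔽 d (n ^ (r + d * m)))
      open Complexity 𝔽 (TVar 𝔽 d (n ^ (r + d * m)))

-- Treewidth of the line graph of K_d, beginning with sums of squares of class sizes.

module LineGraphTreewidth where

  open import Data.Nat.Base using (_+_; _*_; _∸_)
  open SumProperties ℕ.+-*-semiring using (sum; sum-cong-≗; ∑-distrib-+; *-distribʳ-sum; *-distribˡ-sum)
  open import Data.List.Base using (length; _++_; cartesianProduct)
  open ListAll using (All)
  open import Data.List.Membership.Propositional using (_∈_; _∉_)
  open import Data.List.Membership.Propositional.Properties
    using (∈-allFin; ∈-filter⁺; ∈-map⁺; ∈-map⁻; ∈-++⁺ˡ; ∈-++⁺ʳ; ∈-++⁻; ∈-cartesianProduct⁺; ∈-cartesianProduct⁻;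
           ∈-deduplicate⁺; ∈-deduplicate⁻)
  open import Data.List.Properties using (length-map; length-++; length-tabulate; length-mapMaybe; length-deduplicate)
  open import Data.List.Relation.Unary.All.Properties using (all-filter)
  open import Data.List.Relation.Unary.Any using (here; there)
  open import Data.List.Relation.Unary.Unique.DecPropositional.Properties using (deduplicate-!)
  open import Data.Maybe.Base using (Maybe; just; nothing)
  import Data.Vec.Functional as VecF
  open import Relation.Binary.Construct.Closure.ReflexiveTransitive as Star using (Star; ε; _◅_; _◅◅_)
  open import Relation.Binary.Definitions using (DecidableEquality; tri<; tri≈; tri>)

  δ : ∀ {n} → Fin n → Fin n → ℕ
  δ i j with i ≟ j
  ... | yes _ = 1
  ... | no  _ = 0

  δ-≡ : ∀ {n} {i j : Fin n} → i ≡ j → δ i j ≡ 1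
  δ-≡ {i = i} {j} p with i ≟ j
  ... | yes _  = refl
  ... | no  ¬p = contradiction p ¬p

  δ-≢ : ∀ {n} {i j : Fin n} → i ≢ j → δ i j ≡ 0
  δ-≢ {i = i} {j} ¬p with i ≟ j
  ... | yes p = contradiction p ¬p
  ... | no  _ = refl

  δ≤1 : ∀ {n} (i j : Fin n) → δ i j ≤ 1
  δ≤1 i j with i ≟ j
  ... | yes _ = ≤-refl
  ... | no  _ = z≤n

  δ-suc : ∀ {n} (i j : Fin n) → δ (suc i) (suc j) ≡ δ i j
  δ-suc i j = by-cases (i ≟ j)
    where
    by-cases : Dec (i ≡ j) → δ (suc i) (suc j) ≡ δ i j
    by-cases (yes p) = trans (δ-≡ (cong suc p)) (sym (δ-≡ p))
    by-cases (no ¬p) = trans (δ-≢ λ q → ¬p (Fin.suc-injective q)) (sym (δ-≢ ¬p))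

  sum-mono : ∀ {n} {f g : Fin n → ℕ} → (∀ i → f i ≤ g i) → sum f ≤ sum g
  sum-mono {zero}  h = z≤n
  sum-mono {suc n} h = ℕ.+-mono-≤ (h zero) (sum-mono (h ∘ suc))

  sum-const : ∀ n x → sum {n} (λ _ → x) ≡ n * x
  sum-const zero    x = refl
  sum-const (suc n) x = cong (x +_) (sum-const n x)

  sum-δ : ∀ {n} (j : Fin n) (f : Fin n → ℕ) → sum (λ i → δ i j * f i) ≡ f j
  sum-δ {suc n} zero f = trans (cong₂ _+_ (ℕ.+-identityʳ (f zero)) (trans (sum-const n 0) (ℕ.*-zeroʳ n))) (ℕ.+-identityʳ (f zero))
  sum-δ (suc j) f = trans (sum-cong-≗ λ i → cong (_* f (suc i)) (δ-suc i j)) (sum-δ j (f ∘ suc))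

  module Classes {d k : ℕ} (f : Fin d → Fin k) where

    -- Indexed by elements and not by classes, so that `sum class` is the sum of the squares of the
    -- class sizes.
    class : Fin d → ℕ
    class r = sum λ v → δ (f v) (f r)

    class≥1 : ∀ r → 1 ≤ class r
    class≥1 r = ≤-trans (≤-reflexive (sym (sum-δ r (λ _ → 1)))) (sum-mono h)
      where
      h : ∀ i → δ i r * 1 ≤ δ (f i) (f r)
      h i with i ≟ r
      ... | yes p = ≤-reflexive (sym (δ-≡ (cong f p)))
      ... | no  _ = z≤n

    class-cong : ∀ {r s} → f r ≡ f s → class r ≡ class s
    class-cong p = sum-cong-≗ λ v → cong (δ (f v)) p

    δδ≤1 : ∀ {r s} → f r ≢ f s → ∀ v → δ (f v) (f r) + δ (f v) (f s) ≤ 1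
    δδ≤1 {r} {s} r≢s v with f v ≟ f r
    ... | yes p = ≤-reflexive (cong suc (δ-≢ λ q → r≢s (trans (sym p) q)))
    ... | no  _ = δ≤1 (f v) (f s)

    disjoint₃ : ∀ {r s t} → f r ≢ f s → f r ≢ f t → f s ≢ f t → class r + class s + class t ≤ d
    disjoint₃ {r} {s} {t} r≢s r≢t s≢t = begin
      class r + class s + class t
        ≡⟨ cong (_+ class t) (∑-distrib-+ (λ v → δ (f v) (f r)) (λ v → δ (f v) (f s))) ⟨
      sum (λ v → δ (f v) (f r) + δ (f v) (f s)) + class t
        ≡⟨ ∑-distrib-+ (λ v → δ (f v) (f r) + δ (f v) (f s)) (λ v → δ (f v) (f t)) ⟨
      sum (λ v → δ (f v) (f r) + δ (f v) (f s) + δ (f v) (f t))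
        ≤⟨ sum-mono h ⟩
      sum {d} (λ v → 1)
        ≡⟨ trans (sum-const d 1) (ℕ.*-identityʳ d) ⟩
      d ∎
      where
      open ℕ.≤-Reasoning
      h : ∀ v → δ (f v) (f r) + δ (f v) (f s) + δ (f v) (f t) ≤ 1
      h v with f v ≟ f t
      ... | no  _ = ≤-trans (≤-reflexive (ℕ.+-identityʳ _)) (δδ≤1 r≢s v)
      ... | yes p = ≤-reflexive (cong₂ (λ x y → x + y + 1)
                      (δ-≢ λ q → r≢t (trans (sym q) p)) (δ-≢ λ q → s≢t (trans (sym q) p)))

  module SmallClasses {d k h g′} (f : Fin d → Fin k) (z : Fin d) (d≡ : d ≡ suc (h + suc g′)) (g≤h : suc g′ ≤ h) (h≤1+g : h ≤ suc (suc g′)) where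
    open Classes f
    private
      g = suc g′

    -- The extremal class sizes are h, g and 1.
    module _ (small : ∀ r → class r + (h ∸ g) * δ (f z) (f r) ≤ h) where

      class≤h : ∀ r → class r ≤ h
      class≤h r = ≤-trans (ℕ.m≤m+n (class r) _) (small r)

      zero-class≤g : ∀ {r} → f z ≡ f r → class r ≤ g
      zero-class≤g {r} p = ℕ.+-cancelʳ-≤ (h ∸ g) (class r) g (begin
        class r + (h ∸ g)                      ≡⟨ cong (class r +_) (trans (cong ((h ∸ g) *_) (δ-≡ p)) (ℕ.*-identityʳ (h ∸ g))) ⟨
        class r + (h ∸ g) * δ (f z) (f r)   ≤⟨ small r ⟩
        h                                      ≡⟨ ℕ.m+[n∸m]≡n g≤h ⟨
        g + (h ∸ g) ∎)
        where open ℕ.≤-Reasoning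

      -- If z lies in neither class, it takes up one more vertex and leaves at most d - h - 1 = g
      -- for the class of s. If z lies with r, then h ≤ `class r` ≤ g, and the general bound h
      -- suffices.
      other≤g : ∀ {r} → h ≤ class r → ∀ {s} → f r ≢ f s → class s ≤ g
      other≤g {r} h≤ {s} r≢s = by-cases (f z ≟ f s) (f z ≟ f r)
        where
        open ℕ.≤-Reasoning
        by-cases : Dec (f z ≡ f s) → Dec (f z ≡ f r) → class s ≤ g
        by-cases (yes p)     _       = zero-class≤g p
        by-cases (no zero≢s) (yes p) = ≤-trans (class≤h s) (≤-trans h≤ (zero-class≤g p))
        by-cases (no zero≢s) (no zero≢r) = ℕ.+-cancelˡ-≤ (suc h) (class s) g (begin
          suc h + class s                      ≡⟨ cong (_+ class s) (ℕ.+-comm 1 h) ⟩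
          h + 1 + class s                      ≤⟨ ℕ.+-monoˡ-≤ (class s) (ℕ.+-mono-≤ h≤ (class≥1 z)) ⟩
          class r + class z + class s       ≤⟨ disjoint₃ (zero≢r ∘ sym) r≢s zero≢s ⟩
          d                                    ≡⟨ d≡ ⟩
          suc h + g ∎)

      -- If no class reaches h, every term is below h. Otherwise one class has h elements, and
      -- either a second one has g, which leaves a single vertex, or all others have fewer than g.
      -- Each case is a linear estimate, element by element.
      sum-class≤ : sum class ≤ h * h + g * g + 1
      sum-class≤ with any? (λ r → h ℕ.≤? class r)
      ... | no ¬r = begin
        sum class                ≤⟨ sum-mono (λ r → ℕ.≤-pred (≤-trans (ℕ.≰⇒> (λ q → ¬r (r , q))) (≤-reflexive (sym eq₀)))) ⟩
        sum {d} (λ _ → h′)       ≡⟨ sum-const d h′ ⟩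
        d * h′                   ≡⟨ trans (cong (_* h′) d≡) (cong (λ h → suc (h + g) * h′) (sym eq₀)) ⟩
        suc (suc h′ + g) * h′    ≡⟨ eq₁ h′ g ⟩
        h′ * h′ + h′ * 2 + g * h′ ≤⟨ ℕ.+-monoʳ-≤ (h′ * h′ + h′ * 2) (ℕ.*-monoʳ-≤ g h′≤g) ⟩
        h′ * h′ + h′ * 2 + g * g ≤⟨ ℕ.m≤m+n _ 2 ⟩
        h′ * h′ + h′ * 2 + g * g + 2 ≡⟨ eq₂ h′ g ⟩
        suc h′ * suc h′ + g * g + 1 ≡⟨ cong (λ h → h * h + g * g + 1) eq₀ ⟩
        h * h + g * g + 1 ∎
        where
        open ℕ.≤-Reasoning
        h′ = ℕ.pred h
        eq₀ : suc h′ ≡ h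
        eq₀ = ℕ.suc-pred h {{ℕ.>-nonZero (≤-trans (s≤s z≤n) g≤h)}}
        h′≤g : h′ ≤ g
        h′≤g = ℕ.pred-mono-≤ h≤1+g
        eq₁ : ∀ a g → suc (suc a + g) * a ≡ a * a + a * 2 + g * a
        eq₁ = solve-∀
        eq₂ : ∀ a g → a * a + a * 2 + g * g + 2 ≡ suc a * suc a + g * g + 1
        eq₂ = solve-∀
      ... | yes (r , h≤) with any? (λ s → ¬? (f r ≟ f s) ×-dec (g ℕ.≤? class s))
      -- Adding h + g avoids subtraction: beyond 1, an element of the first class contributes at
      -- most h - 1, one of the second at most g - 1, and the remaining one nothing.
      ...   | yes (s , r≢s , g≤) = ℕ.+-cancelʳ-≤ (h + g) _ _ (begin
        sum class + (h + g)
          ≤⟨ ℕ.+-monoʳ-≤ (sum class) (ℕ.+-mono-≤ h≤ g≤) ⟩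
        sum class + (class r + class s)
          ≡⟨ trans (sym (ℕ.+-assoc (sum class) _ _)) (cong (λ x → x + class s) (sym (∑-distrib-+ class (λ t → δ (f t) (f r))))) ⟩
        sum (λ t → class t + δ (f t) (f r)) + class s
          ≡⟨ ∑-distrib-+ (λ t → class t + δ (f t) (f r)) (λ t → δ (f t) (f s)) ⟨
        sum (λ t → class t + δ (f t) (f r) + δ (f t) (f s))
          ≤⟨ sum-mono pointwise ⟩
        sum (λ t → 1 + δ (f t) (f r) * h + δ (f t) (f s) * g)
          ≡⟨ ∑-distrib-+ (λ t → 1 + δ (f t) (f r) * h) (λ t → δ (f t) (f s) * g) ⟩
        sum (λ t → 1 + δ (f t) (f r) * h) + sum (λ t → δ (f t) (f s) * g)
          ≡⟨ cong₂ _+_ (∑-distrib-+ (λ t → 1) (λ t → δ (f t) (f r) * h)) (sym (*-distribʳ-sum g (λ t → δ (f t) (f s)))) ⟩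
        sum {d} (λ t → 1) + sum (λ t → δ (f t) (f r) * h) + class s * g
          ≡⟨ cong₂ (λ x y → x + y + class s * g) (trans (sum-const d 1) (ℕ.*-identityʳ d)) (sym (*-distribʳ-sum h (λ t → δ (f t) (f r)))) ⟩
        d + class r * h + class s * g
          ≤⟨ ℕ.+-mono-≤ (ℕ.+-monoʳ-≤ d (ℕ.*-monoˡ-≤ h (class≤h r))) (ℕ.*-monoˡ-≤ g (other≤g h≤ r≢s)) ⟩
        d + h * h + g * g
          ≡⟨ trans (cong (λ x → x + h * h + g * g) d≡) (eq h g) ⟩
        h * h + g * g + 1 + (h + g) ∎)
        where
        open ℕ.≤-Reasoning
        eq : ∀ h g → suc (h + g) + h * h + g * g ≡ h * h + g * g + 1 + (h + g)
        eq = solve-∀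
        pointwise : ∀ t → class t + δ (f t) (f r) + δ (f t) (f s) ≤ 1 + δ (f t) (f r) * h + δ (f t) (f s) * g
        pointwise t with f t ≟ f r | f t ≟ f s
        ... | yes p | yes q = contradiction (trans (sym p) q) r≢s
        ... | yes p | no  _ = ≤-trans (≤-reflexive (trans (ℕ.+-identityʳ _) (ℕ.+-comm _ 1)))
                                (s≤s (≤-trans (class≤h t) (≤-reflexive (sym (trans (ℕ.+-identityʳ (h + 0)) (ℕ.+-identityʳ h))))))
        ... | no  _ | yes q = ≤-trans (≤-reflexive (trans (cong (_+ 1) (ℕ.+-identityʳ _)) (ℕ.+-comm _ 1)))
                                (s≤s (≤-trans (≤-reflexive (class-cong q)) (≤-trans (other≤g h≤ r≢s) (≤-reflexive (sym (ℕ.+-identityʳ g))))))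
        ... | no  p | no  q = ≤-trans (≤-reflexive (trans (ℕ.+-identityʳ _) (ℕ.+-identityʳ _)))
                                (ℕ.+-cancelˡ-≤ (h + g) (class t) 1 (≤-trans (ℕ.+-monoˡ-≤ (class t) (ℕ.+-mono-≤ h≤ g≤))
                                  (≤-trans (disjoint₃ r≢s (p ∘ sym) (q ∘ sym)) (≤-reflexive (trans d≡ (ℕ.+-comm 1 (h + g)))))))
      ...   | no ¬s = begin
        sum class
          ≤⟨ sum-mono pointwise ⟩
        sum (λ t → g′ + δ (f t) (f r) * (h ∸ g′))
          ≡⟨ ∑-distrib-+ (λ t → g′) (λ t → δ (f t) (f r) * (h ∸ g′)) ⟩
        sum {d} (λ t → g′) + sum (λ t → δ (f t) (f r) * (h ∸ g′))
          ≡⟨ cong₂ _+_ (sum-const d g′) (sym (*-distribʳ-sum (h ∸ g′) (λ t → δ (f t) (f r)))) ⟩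
        d * g′ + class r * (h ∸ g′)
          ≤⟨ ℕ.+-monoʳ-≤ (d * g′) (ℕ.*-monoˡ-≤ (h ∸ g′) (class≤h r)) ⟩
        d * g′ + h * (h ∸ g′)
          ≡⟨ trans (cong (λ x → x * g′ + h * (h ∸ g′)) d≡) (eq₁ h g′ (h ∸ g′)) ⟩
        h * (g′ + (h ∸ g′)) + (g′ * g′ + g′ * 2)
          ≡⟨ cong (λ x → h * x + (g′ * g′ + g′ * 2)) (ℕ.m+[n∸m]≡n (≤-trans (ℕ.n≤1+n g′) g≤h)) ⟩
        h * h + (g′ * g′ + g′ * 2)
          ≤⟨ ℕ.m≤m+n _ 2 ⟩
        h * h + (g′ * g′ + g′ * 2) + 2
          ≡⟨ eq₂ h g′ ⟩
        h * h + g * g + 1 ∎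
        where
        open ℕ.≤-Reasoning
        eq₁ : ∀ h a b → suc (h + suc a) * a + h * b ≡ h * (a + b) + (a * a + a * 2)
        eq₁ = solve-∀
        eq₂ : ∀ h a → h * h + (a * a + a * 2) + 2 ≡ h * h + suc a * suc a + 1
        eq₂ = solve-∀
        pointwise : ∀ t → class t ≤ g′ + δ (f t) (f r) * (h ∸ g′)
        pointwise t with f t ≟ f r
        ... | yes _ = ≤-trans (class≤h t) (≤-reflexive (sym (trans (cong (g′ +_) (ℕ.+-identityʳ (h ∸ g′)))
                        (ℕ.m+[n∸m]≡n (≤-trans (ℕ.n≤1+n g′) g≤h)))))
        ... | no  p = ≤-trans (ℕ.≤-pred (ℕ.≰⇒> λ q → ¬s (t , p ∘ sym , q))) (≤-reflexive (sym (ℕ.+-identityʳ g′)))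

  -- Helly property of subtrees, by removing a leaf: since some T i misses the leaf,
  -- all of them reach beyond it and hence contain its parent whenever they contain it.
  Within : {m : ℕ} → Tree m → (Fin m → Set) → Fin m → Fin m → Set
  Within t T a b = TreeAdj t a b × T a × T b

  helly : {I : Set} {m : ℕ} (t : Tree m) (T : I → Fin m → Set) → I →
    (∀ i x y → T i x → T i y → Star (Within t (T i)) x y) →
    (∀ i j → ∃[ x ] (T i x × T j x)) →
    ¬ (∀ x → ∃[ i ] ¬ T i x)
  helly single T i conn meet avoid with avoid zero | meet i i
  ... | j , ¬Tj | _ with meet j j
  ... | zero , Tj , _ = ¬Tj Tj
  helly {I} (attach {m} t p) T i conn meet avoid = helly t (λ i x → T i (suc x)) i conn′ meet′ (avoid ∘ suc)
    where
    φ : Fin (suc m) → Fin m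
    φ zero    = p
    φ (suc x) = x
    project : ∀ {i x y} → Star (Within (attach t p) (T i)) x y → Star (Within t (λ x → T i (suc x))) (φ x) (φ y)
    project ε = ε
    project ((down , _) ◅ s) = project s
    project ((up , _) ◅ s) = project s
    project ((old xy , Tx , Ty) ◅ s) = (xy , Tx , Ty) ◅ project s
    conn′ : ∀ i x y → T i (suc x) → T i (suc y) → Star (Within t (λ x → T i (suc x))) x y
    conn′ i x y Tx Ty = project (conn i (suc x) (suc y) Tx Ty)
    beyond : ∀ i → ∃[ x ] T i (suc x)
    beyond i with avoid zero
    ... | j , ¬Tj with meet i j
    ...   | zero  , _  , Tj = contradiction Tj ¬Tj
    ...   | suc x , Ti , _  = x , Ti
    first : ∀ {i x} → Star (Within (attach t p) (T i)) zero (suc x) → T i (suc p)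
    first ((up , _ , Tp) ◅ _) = Tp
    parent : ∀ i → T i zero → T i (suc p)
    parent i Ti = first (conn i zero _ Ti (proj₂ (beyond i)))
    meet′ : ∀ i j → ∃[ x ] (T i (suc x) × T j (suc x))
    meet′ i j with meet i j
    ... | suc x , Ti , Tj = x , Ti , Tj
    ... | zero  , Ti , Tj = p , parent i Ti , parent j Tj

  module _ {A B : Set} {f : A → Maybe B} where

    ∈-mapMaybe⁺ : ∀ {xs x y} → x ∈ xs → f x ≡ just y → y ∈ List.mapMaybe f xs
    ∈-mapMaybe⁺ (here refl) eq rewrite eq = here refl
    ∈-mapMaybe⁺ {x′ ∷ _} (there x∈xs) eq with f x′
    ... | just _  = there (∈-mapMaybe⁺ x∈xs eq)
    ... | nothing = ∈-mapMaybe⁺ x∈xs eq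

    ∈-mapMaybe⁻ : ∀ {xs y} → y ∈ List.mapMaybe f xs → ∃[ x ] (x ∈ xs × f x ≡ just y)
    ∈-mapMaybe⁻ {x ∷ xs} y∈ with f x in eq
    ∈-mapMaybe⁻ {x ∷ xs} (here refl) | just _  = x , here refl , eq
    ∈-mapMaybe⁻ {x ∷ xs} (there y∈)  | just _  = let x′ , x′∈ , eq′ = ∈-mapMaybe⁻ y∈ in x′ , there x′∈ , eq′
    ∈-mapMaybe⁻ {x ∷ xs} y∈          | nothing = let x′ , x′∈ , eq′ = ∈-mapMaybe⁻ y∈ in x′ , there x′∈ , eq′

  module _ {d : ℕ} where

    E : Set
    E = Edge (K d)

    infix 4 _≟ᴱ_
    _≟ᴱ_ : DecidableEquality E
    edge a b _ _ ≟ᴱ edge a′ b′ _ _ with a ≟ a′ | b ≟ b′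
    ... | yes refl | yes refl = yes refl
    ... | no ¬p    | _        = no λ { refl → ¬p refl }
    ... | yes _    | no ¬q    = no λ { refl → ¬q refl }

    open import Data.List.Membership.DecPropositional _≟ᴱ_ using (_∈?_; _∉?_)

    toEdge : Fin d × Fin d → Maybe E
    toEdge (a , b) with a Fin.<? b
    ... | yes a<b = just (edge a b a<b (Fin.<⇒≢ a<b))
    ... | no  _   = nothing

    toEdge-just : (e : E) → toEdge (Edge.u e , Edge.v e) ≡ just e
    toEdge-just (edge a b a<b _) with a Fin.<? b
    ... | yes _  = refl
    ... | no a≮b = ⊥-elim-irr (a≮b a<b)

    allEdges : List E
    allEdges = List.mapMaybe toEdge (List.cartesianProduct (List.allFin d) (List.allFin d))

    ∈-allEdges : (e : E) → e ∈ allEdges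
    ∈-allEdges e = ∈-mapMaybe⁺ (∈-cartesianProduct⁺ (∈-allFin (Edge.u e)) (∈-allFin (Edge.v e))) (toEdge-just e)

    edgeBetween : ∀ {a b} → a ≢ b → Σ[ e ∈ E ] (Edge.u e ≡ a × Edge.v e ≡ b ⊎ Edge.u e ≡ b × Edge.v e ≡ a)
    edgeBetween {a} {b} a≢b with Fin.<-cmp a b
    ... | tri< a<b _ _ = edge a b a<b a≢b , inj₁ (refl , refl)
    ... | tri≈ _ a≡b _ = contradiction a≡b a≢b
    ... | tri> _ _ b<a = edge b a b<a (a≢b ∘ sym) , inj₂ (refl , refl)

    -- Components of K_d after the deletion of an edge list.

    Link : List E → Fin d → Fin d → Set
    Link B a b = ∃[ e ] (e ∉ B × a ∈ᴱ e × b ∈ᴱ e)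

    Reach : List E → Fin d → Fin d → Set
    Reach B = Star (Link B)

    Reach-sym : ∀ {B a b} → Reach B a b → Reach B b a
    Reach-sym = Star.reverse λ (e , e∉B , a∈e , b∈e) → e , e∉B , b∈e , a∈e

    Components : List E → (Fin d → Fin d) → Set
    Components B f = (∀ {a b} → f a ≡ f b → Reach B a b) × (∀ e → e ∉ B → f (Edge.u e) ≡ f (Edge.v e))

    -- The edges outside B are added one at a time, each merging the fibre of one end into the fibre
    -- of the other.
    components : ∀ B → ∃[ f ] Components B f
    components B = let f , reach , join = unionFind (List.filter (_∉? B) allEdges) (all-filter (_∉? B) allEdges) in
      f , reach , λ e e∉B → ListAll.lookup join (∈-filter⁺ (_∉? B) (∈-allEdges e) e∉B)
      where
      unionFind : ∀ L → All (_∉ B) L → ∃[ f ] ((∀ {a b} → f a ≡ f b → Reach B a b) × All (λ e → f (Edge.u e) ≡ f (Edge.v e)) L)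
      unionFind []      []           = id , (λ { refl → ε }) , []
      unionFind (e ∷ L) (e∉B ∷ L∉B) with unionFind L L∉B
      ... | f , reach , join = φ ∘ f , reach′ , trans (φ-u refl) (sym φ-v) ∷ ListAll.map (cong φ) join
        where
        p = f (Edge.u e)
        q = f (Edge.v e)
        φ : Fin d → Fin d
        φ x with x ≟ p
        ... | yes _ = q
        ... | no  _ = x
        φ-u : ∀ {x} → x ≡ p → φ x ≡ q
        φ-u {x} x≡p with x ≟ p
        ... | yes _  = refl
        ... | no x≢p = contradiction x≡p x≢p
        φ-other : ∀ {x} → x ≢ p → φ x ≡ x
        φ-other {x} x≢p with x ≟ p
        ... | yes x≡p = contradiction x≡p x≢p
        ... | no  _   = refl
        φ-v : φ q ≡ q
        φ-v with q ≟ p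
        ... | yes _ = refl
        ... | no  _ = refl
        u→v : Reach B (Edge.u e) (Edge.v e)
        u→v = (e , e∉B , inj₁ refl , inj₂ refl) ◅ ε
        reach′ : ∀ {a b} → φ (f a) ≡ φ (f b) → Reach B a b
        reach′ {a} {b} eq = by-cases (f a ≟ p) (f b ≟ p)
          where
          by-cases : Dec (f a ≡ p) → Dec (f b ≡ p) → Reach B a b
          by-cases (yes a≡) (yes b≡) = reach (trans a≡ (sym b≡))
          by-cases (yes a≡) (no b≢)  = reach a≡ ◅◅ u→v ◅◅ reach (trans (sym (φ-u a≡)) (trans eq (φ-other b≢)))
          by-cases (no a≢)  (yes b≡) = Reach-sym (reach b≡ ◅◅ u→v ◅◅ reach (trans (sym (φ-u b≡)) (trans (sym eq) (φ-other a≢))))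
          by-cases (no a≢)  (no b≢)  = reach (trans (sym (φ-other a≢)) (trans eq (φ-other b≢)))

    occ₁ : E → Fin d → Fin d → ℕ
    occ₁ e a b = δ a (Edge.u e) * δ b (Edge.v e) + δ a (Edge.v e) * δ b (Edge.u e)

    occ : List E → Fin d → Fin d → ℕ
    occ []      a b = 0
    occ (e ∷ B) a b = occ₁ e a b + occ B a b

    sum-δδ : ∀ u v → sum {d} (λ a → sum {d} λ b → δ a u * δ b v) ≡ 1
    sum-δδ u v = begin
      sum {d} (λ a → sum {d} λ b → δ a u * δ b v) ≡⟨ sum-cong-≗ {d} (λ a → sym (*-distribˡ-sum {d} (δ a u) (λ b → δ b v))) ⟩
      sum {d} (λ a → δ a u * sum {d} λ b → δ b v) ≡⟨ sum-δ u (λ _ → sum {d} λ b → δ b v) ⟩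
      sum {d} (λ b → δ b v)                       ≡⟨ sum-cong-≗ {d} (λ b → sym (ℕ.*-identityʳ (δ b v))) ⟩
      sum {d} (λ b → δ b v * 1)                   ≡⟨ sum-δ v (λ _ → 1) ⟩
      1 ∎
      where open ≡.≡-Reasoning

    sum-sum-+ : (f g : Fin d → Fin d → ℕ) →
      sum (λ a → sum λ b → f a b + g a b) ≡ sum (λ a → sum (f a)) + sum (λ a → sum (g a))
    sum-sum-+ f g = trans (sum-cong-≗ {d} λ a → ∑-distrib-+ {d} (f a) (g a)) (∑-distrib-+ {d} (λ a → sum (f a)) (λ a → sum (g a)))

    sum-occ : ∀ B → sum (λ a → sum (occ B a)) ≡ 2 * length B
    sum-occ []      = trans (sum-cong-≗ {d} λ a → trans (sum-const d 0) (ℕ.*-zeroʳ d)) (trans (sum-const d 0) (ℕ.*-zeroʳ d))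
    sum-occ (e ∷ B) = begin
      sum (λ a → sum λ b → occ₁ e a b + occ B a b)                ≡⟨ sum-sum-+ (occ₁ e) (occ B) ⟩
      sum (λ a → sum (occ₁ e a)) + sum (λ a → sum (occ B a))      ≡⟨ cong₂ _+_ (trans (sum-sum-+ (λ a b → δ a (Edge.u e) * δ b (Edge.v e)) _)
                                                                       (cong₂ _+_ (sum-δδ (Edge.u e) (Edge.v e)) (sum-δδ (Edge.v e) (Edge.u e)))) (sum-occ B) ⟩
      2 + 2 * length B                                            ≡⟨ eq (length B) ⟩
      2 * suc (length B) ∎
      where
      open ≡.≡-Reasoning
      eq : ∀ n → 2 + 2 * n ≡ 2 * suc n
      eq = solve-∀

    occ≥1 : ∀ {B e a b} → e ∈ B → (Edge.u e ≡ a × Edge.v e ≡ b ⊎ Edge.u e ≡ b × Edge.v e ≡ a) → 1 ≤ occ B a b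
    occ≥1 {e ∷ B} {_} {a} {b} (here refl) (inj₁ (p , q)) =
      ≤-trans (≤-reflexive (sym (cong₂ _*_ (δ-≡ (sym p)) (δ-≡ (sym q)))))
        (≤-trans (ℕ.m≤m+n (δ a (Edge.u e) * δ b (Edge.v e)) _) (ℕ.m≤m+n (occ₁ e a b) _))
    occ≥1 {e ∷ B} {_} {a} {b} (here refl) (inj₂ (p , q)) =
      ≤-trans (≤-reflexive (sym (cong₂ _*_ (δ-≡ (sym q)) (δ-≡ (sym p)))))
        (≤-trans (ℕ.m≤n+m (δ a (Edge.v e) * δ b (Edge.u e)) _) (ℕ.m≤m+n (occ₁ e a b) _))
    occ≥1 (there e∈B) ends = ≤-trans (occ≥1 e∈B ends) (ℕ.m≤n+m _ _)

    -- Each of the d^2 ordered pairs lies within a fibre of f or is joined by an edge of B. An edge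
    -- accounts for two pairs; the pairs within fibres add up to the sum of squared sizes.
    square≤ : ∀ {B f} → Components B f → d * d ≤ 2 * length B + sum (Classes.class f)
    square≤ {B} {f} (_ , join) = begin
      d * d                                        ≡⟨ trans (sum-cong-≗ {d} λ _ → trans (sum-const d 1) (ℕ.*-identityʳ d)) (sum-const d d) ⟨
      sum {d} (λ a → sum {d} (λ b → 1))            ≤⟨ sum-mono {d} (λ a → sum-mono {d} (pointwise a)) ⟩
      sum (λ a → sum λ b → occ B a b + δ (f b) (f a)) ≡⟨ sum-sum-+ (occ B) (λ a b → δ (f b) (f a)) ⟩
      sum (λ a → sum (occ B a)) + sum (Classes.class f) ≡⟨ cong (_+ sum (Classes.class f)) (sum-occ B) ⟩
      2 * length B + sum (Classes.class f) ∎
      where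
      open ℕ.≤-Reasoning
      joined : ∀ {a b} → a ≢ b → f b ≢ f a → 1 ≤ occ B a b
      joined a≢b fb≢fa with edgeBetween a≢b
      ... | e , ends with e ∈? B
      ...   | yes e∈B = occ≥1 e∈B ends
      joined a≢b fb≢fa | e , inj₁ (refl , refl) | no e∉B = contradiction (sym (join e e∉B)) fb≢fa
      joined a≢b fb≢fa | e , inj₂ (refl , refl) | no e∉B = contradiction (join e e∉B) fb≢fa
      pointwise : ∀ a b → 1 ≤ occ B a b + δ (f b) (f a)
      pointwise a b with f b ≟ f a
      ... | yes _    = ℕ.m≤n+m 1 _
      ... | no fb≢fa = ≤-trans (joined (λ a≡b → fb≢fa (cong f (sym a≡b))) fb≢fa) (ℕ.m≤m+n _ 0)

    -- The lower bound on the treewidth.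

    module LowerBound {h g′ : ℕ} (z : Fin d) (d≡ : d ≡ suc (h + suc g′)) (g≤h : suc g′ ≤ h) (h≤1+g : h ≤ suc (suc g′)) where

      private
        g = suc g′
        W = h * g + h + g

      -- z counts twice when d is even, so that two vertex sets of more than half of the
      -- total weight always meet.
      weight : Fin d → ℕ
      weight v = 1 + δ v z * (h ∸ g)

      mass : (Fin d → Fin d) → Fin d → ℕ
      mass f r = sum λ v → weight v * δ (f v) (f r)

      sum-weight : sum weight < suc h + suc h
      sum-weight = s≤s (≤-reflexive (begin
        sum weight                          ≡⟨ ∑-distrib-+ {d} (λ _ → 1) (λ v → δ v z * (h ∸ g)) ⟩
        sum {d} (λ _ → 1) + sum (λ v → δ v z * (h ∸ g))
                                            ≡⟨ cong₂ _+_ (trans (sum-const d 1) (trans (ℕ.*-identityʳ d) d≡)) (sum-δ z (λ _ → h ∸ g)) ⟩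
        suc (h + g) + (h ∸ g)               ≡⟨ cong suc (trans (ℕ.+-assoc h g (h ∸ g)) (cong (h +_) (ℕ.m+[n∸m]≡n g≤h))) ⟩
        suc (h + h)                         ≡⟨ ℕ.+-suc h h ⟨
        h + suc h ∎))
        where open ≡.≡-Reasoning

      mass-class : ∀ f r → mass f r ≡ Classes.class f r + (h ∸ g) * δ (f z) (f r)
      mass-class f r = begin
        sum (λ v → weight v * δ (f v) (f r))
          ≡⟨ sum-cong-≗ {d} (λ v → eq (δ v z) (h ∸ g) (δ (f v) (f r))) ⟩
        sum (λ v → δ (f v) (f r) + δ v z * ((h ∸ g) * δ (f v) (f r)))
          ≡⟨ ∑-distrib-+ {d} (λ v → δ (f v) (f r)) _ ⟩
        Classes.class f r + sum (λ v → δ v z * ((h ∸ g) * δ (f v) (f r)))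
          ≡⟨ cong (Classes.class f r +_) (sum-δ z (λ v → (h ∸ g) * δ (f v) (f r))) ⟩
        Classes.class f r + (h ∸ g) * δ (f z) (f r) ∎
        where
        open ≡.≡-Reasoning
        eq : ∀ a b c → (1 + a * b) * c ≡ c + a * (b * c)
        eq = solve-∀

      -- Otherwise `square≤` and `sum-class≤` give d^2 ≤ 2 `length B` + h^2 + g^2 + 1, whereas d^2 =
      -- 2 W + h^2 + g^2 + 1.
      heavy : ∀ {B f} → Components B f → length B < W → ∃[ r ] suc h ≤ mass f r
      heavy {B} {f} comps B<W with any? (λ r → suc h ℕ.≤? mass f r)
      ... | yes r  = r
      ... | no  ¬r = contradiction (begin
        2 * W + (h * h + g * g + 1)  ≡⟨ eq h g ⟩
        suc (h + g) * suc (h + g)    ≡⟨ cong₂ _*_ d≡ d≡ ⟨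
        d * d                        ≤⟨ square≤ comps ⟩
        2 * length B + sum (Classes.class f)
          ≤⟨ ℕ.+-monoʳ-≤ (2 * length B) (SmallClasses.sum-class≤ f z d≡ g≤h h≤1+g λ r →
               ≤-trans (≤-reflexive (sym (mass-class f r))) (ℕ.≤-pred (ℕ.≰⇒> λ q → ¬r (r , q)))) ⟩
        2 * length B + (h * h + g * g + 1) ∎)
        (ℕ.<⇒≱ (ℕ.+-monoˡ-< (h * h + g * g + 1) (ℕ.*-monoʳ-< 2 B<W)))
        where
        open ℕ.≤-Reasoning
        eq : ∀ h g → 2 * (h * g + h + g) + (h * h + g * g + 1) ≡ suc (h + g) * suc (h + g)
        eq = solve-∀

      heavy-meet : ∀ f f′ r r′ → suc h ≤ mass f r → suc h ≤ mass f′ r′ → ∃[ v ] (f v ≡ f r × f′ v ≡ f′ r′)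
      heavy-meet f f′ r r′ m m′ with any? (λ v → (f v ≟ f r) ×-dec (f′ v ≟ f′ r′))
      ... | yes v = v
      ... | no ¬v = contradiction (begin
        suc h + suc h        ≤⟨ ℕ.+-mono-≤ m m′ ⟩
        mass f r + mass f′ r′ ≡⟨ ∑-distrib-+ {d} (λ v → weight v * δ (f v) (f r)) _ ⟨
        sum (λ v → weight v * δ (f v) (f r) + weight v * δ (f′ v) (f′ r′)) ≤⟨ sum-mono {d} pointwise ⟩
        sum weight ∎) (ℕ.<⇒≱ sum-weight)
        where
        open ℕ.≤-Reasoning
        pointwise : ∀ v → weight v * δ (f v) (f r) + weight v * δ (f′ v) (f′ r′) ≤ weight v
        pointwise v = begin
          weight v * δ (f v) (f r) + weight v * δ (f′ v) (f′ r′) ≡⟨ ℕ.*-distribˡ-+ (weight v) (δ (f v) (f r)) _ ⟨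
          weight v * (δ (f v) (f r) + δ (f′ v) (f′ r′))          ≤⟨ ℕ.*-monoʳ-≤ (weight v) (by-cases (f v ≟ f r)) ⟩
          weight v * 1                                           ≡⟨ ℕ.*-identityʳ (weight v) ⟩
          weight v ∎
          where
          by-cases : Dec (f v ≡ f r) → δ (f v) (f r) + δ (f′ v) (f′ r′) ≤ 1
          by-cases (yes p) = ≤-reflexive (cong₂ _+_ (δ-≡ p) (δ-≢ λ q → ¬v (v , p , q)))
          by-cases (no ¬p) = ≤-trans (≤-reflexive (cong (_+ δ (f′ v) (f′ r′)) (δ-≢ ¬p))) (δ≤1 (f′ v) (f′ r′))

      -- A single vertex weighs at most 1 + (h - g) ≤ h, because g ≥ 1. So a heavy component has an
      -- edge at each of its vertices, and is thereby visible in the line graph.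
      companion : ∀ f r v → f v ≡ f r → suc h ≤ mass f r → ∃[ v′ ] (v ≢ v′ × f v ≡ f v′)
      companion f r v fv m with any? (λ v′ → ¬? (v ≟ v′) ×-dec (f v ≟ f v′))
      ... | yes v′ = v′
      ... | no ¬v′ = contradiction (begin
        suc h                 ≤⟨ m ⟩
        mass f r              ≤⟨ sum-mono {d} pointwise ⟩
        sum (λ w → δ w v * (1 + (h ∸ g)))  ≡⟨ sum-δ v (λ _ → 1 + (h ∸ g)) ⟩
        1 + (h ∸ g)           ≤⟨ ℕ.+-monoˡ-≤ (h ∸ g) (s≤s (z≤n {g′})) ⟩
        g + (h ∸ g)           ≡⟨ ℕ.m+[n∸m]≡n g≤h ⟩
        h ∎) ℕ.1+n≰n
        where
        open ℕ.≤-Reasoning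
        pointwise : ∀ w → weight w * δ (f w) (f r) ≤ δ w v * (1 + (h ∸ g))
        pointwise w = by-cases (w ≟ v)
          where
          by-cases : Dec (w ≡ v) → weight w * δ (f w) (f r) ≤ δ w v * (1 + (h ∸ g))
          by-cases (yes p) = begin
            weight w * δ (f w) (f r)  ≤⟨ ℕ.*-monoʳ-≤ (weight w) (δ≤1 (f w) (f r)) ⟩
            weight w * 1              ≡⟨ ℕ.*-identityʳ (weight w) ⟩
            1 + δ w z * (h ∸ g)       ≤⟨ ℕ.+-monoʳ-≤ 1 (ℕ.*-monoˡ-≤ (h ∸ g) (δ≤1 w z)) ⟩
            1 + (1 * (h ∸ g))         ≡⟨ cong suc (ℕ.*-identityˡ (h ∸ g)) ⟩
            1 + (h ∸ g)               ≡⟨ trans (cong (_* (1 + (h ∸ g))) (δ-≡ p)) (ℕ.*-identityˡ (1 + (h ∸ g))) ⟨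
            δ w v * (1 + (h ∸ g)) ∎
          by-cases (no ¬p) = ≤-trans (≤-reflexive (trans (cong (weight w *_) (δ-≢ λ q → ¬v′ (w , ¬p ∘ sym , trans fv (sym q))))
                               (ℕ.*-zeroʳ (weight w)))) z≤n

      module _ (D : TreeDecomposition (LineGraph (K d))) (small : ∀ x → length (TreeDecomposition.bag D x) < W) where
        open TreeDecomposition D

        comp : Fin nodes → Fin d → Fin d
        comp x = proj₁ (components (bag x))

        comp-ok : ∀ x → Components (bag x) (comp x)
        comp-ok x = proj₂ (components (bag x))

        root : Fin nodes → Fin d
        root x = proj₁ (heavy (comp-ok x) (small x))

        root-heavy : ∀ x → suc h ≤ mass (comp x) (root x)
        root-heavy x = proj₂ (heavy (comp-ok x) (small x))

        -- One end is enough, since the two ends of an edge outside the bag lie in the same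
        -- component.
        InComp : Fin nodes → E → Set
        InComp x e = e ∉ bag x × comp x (Edge.u e) ≡ comp x (root x)

        inComp : ∀ {x e a} → e ∉ bag x → a ∈ᴱ e → comp x a ≡ comp x (root x) → InComp x e
        inComp         e∉ (inj₁ refl) p = e∉ , p
        inComp {x} {e} e∉ (inj₂ refl) p = e∉ , trans (proj₂ (comp-ok x) e e∉) p

        end-comp : ∀ {x e a} → InComp x e → a ∈ᴱ e → comp x a ≡ comp x (root x)
        end-comp         (e∉ , p) (inj₁ refl) = p
        end-comp {x} {e} (e∉ , p) (inj₂ refl) = trans (sym (proj₂ (comp-ok x) e e∉)) p

        -- The edge sets `InComp x` form a bramble of the line graph; `Touches x` holds at the nodes
        -- whose bags meet the member that belongs to x.
        Touches : Fin nodes → Fin nodes → Set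
        Touches x y = ∃[ e ] (e ∈ bag y × InComp x e)

        move : ∀ {x e y y′} → InComp x e → e ∈ bag y → e ∈ bag y′ → Star (Within tree (Touches x)) y y′
        move {e = e} in-e e∈y e∈y′ = Star.map (λ (adj , ea , eb) → adj , (e , ea , in-e) , (e , eb , in-e)) (connected e _ _ e∈y e∈y′)

        common-bag : ∀ {e f a} → a ∈ᴱ e → a ∈ᴱ f → ∃[ c ] (e ∈ bag c × f ∈ bag c)
        common-bag {e} {f} {a} a∈e a∈f with e ≟ᴱ f
        ... | yes refl = let c , e∈c = vertex-bag e in c , e∈c , e∈c
        ... | no  e≢f  = edge-bag e f (e≢f , a , a∈e , a∈f)

        share : ∀ {x e f a y y′} → InComp x e → InComp x f → a ∈ᴱ e → a ∈ᴱ f → e ∈ bag y → f ∈ bag y′ →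
          Star (Within tree (Touches x)) y y′
        share in-e in-f a∈e a∈f e∈y f∈y′ = let c , e∈c , f∈c = common-bag a∈e a∈f in move in-e e∈y e∈c ◅◅ move in-f f∈c f∈y′

        -- Consecutive edges of a path inside the component share a vertex and hence a bag, and the
        -- bags that contain one edge are connected in the tree.
        walk : ∀ {x a b e f y y′} → Reach (bag x) a b → InComp x e → InComp x f → a ∈ᴱ e → b ∈ᴱ f → e ∈ bag y → f ∈ bag y′ →
          Star (Within tree (Touches x)) y y′
        walk ε in-e in-f a∈e b∈f e∈y f∈y′ = share in-e in-f a∈e b∈f e∈y f∈y′
        walk {x} ((k , k∉ , a∈k , c∈k) ◅ s) in-e in-f a∈e b∈f e∈y f∈y′ =
          let c , k∈c = vertex-bag k
              in-k    = inComp k∉ a∈k (end-comp in-e a∈e)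
          in share in-e in-k a∈e a∈k e∈y k∈c ◅◅ walk s in-k in-f c∈k b∈f k∈c f∈y′

        touches-connected : ∀ x y y′ → Touches x y → Touches x y′ → Star (Within tree (Touches x)) y y′
        touches-connected x y y′ (e , e∈y , in-e) (f , f∈y′ , in-f) =
          walk (proj₁ (comp-ok x) (trans (proj₂ in-e) (sym (proj₂ in-f)))) in-e in-f (inj₁ refl) (inj₁ refl) e∈y f∈y′

        edge-at : ∀ x v → comp x v ≡ comp x (root x) → ∃[ e ] (v ∈ᴱ e × InComp x e)
        edge-at x v p with companion (comp x) (root x) v p (root-heavy x)
        ... | v′ , v≢v′ , same with proj₁ (comp-ok x) same
        ...   | ε = contradiction refl v≢v′
        ...   | (e , e∉ , v∈e , _) ◅ _ = e , v∈e , inComp e∉ v∈e p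

        -- The two components have a vertex v in common. An edge at v from the one equals or is
        -- adjacent to an edge at v from the other, so some bag contains both.
        touches-meet : ∀ x x′ → ∃[ y ] (Touches x y × Touches x′ y)
        touches-meet x x′ =
          let v , p , p′      = heavy-meet (comp x) (comp x′) (root x) (root x′) (root-heavy x) (root-heavy x′)
              e , v∈e , in-e  = edge-at x v p
              f , v∈f , in-f  = edge-at x′ v p′
              c , e∈c , f∈c   = common-bag v∈e v∈f
          in c , (e , e∈c , in-e) , (f , f∈c , in-f)

        some-node : ∀ {m} → Tree m → Fin m
        some-node single       = zero
        some-node (attach _ _) = zero

        bags-not-small : ⊥
        bags-not-small = helly tree Touches (some-node tree) touches-connected touches-meet
          λ x → x , λ (e , e∈x , e∉x , _) → e∉x e∈x

  -- The path decomposition and the upper bound on the treewidth.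

  path : ∀ m → Tree (suc m)
  path zero    = single
  path (suc m) = attach (path m) zero

  path-step : ∀ {m} (i : Fin m) → TreeAdj (path m) (inject₁ i) (suc i)
  path-step zero    = up
  path-step (suc i) = old (path-step i)

  TreeAdj-sym : ∀ {m} {t : Tree m} {x y} → TreeAdj t x y → TreeAdj t y x
  TreeAdj-sym down    = up
  TreeAdj-sym up      = down
  TreeAdj-sym (old a) = old (TreeAdj-sym a)

  below : ∀ {n} → Fin n → List (Fin n)
  below x = List.map inject (List.allFin (toℕ x))

  ∈-below⁺ : ∀ {n} {u x : Fin n} → u Fin.< x → u ∈ below x
  ∈-below⁺ {u = u} {x} u<x = subst (_∈ below x)
    (toℕ-injective (trans (toℕ-inject (fromℕ< u<x)) (toℕ-fromℕ< u<x))) (∈-map⁺ inject (∈-allFin (fromℕ< u<x)))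

  ∈-below⁻ : ∀ {n} {u x : Fin n} → u ∈ below x → u Fin.< x
  ∈-below⁻ u∈ with ∈-map⁻ inject u∈
  ... | j , _ , refl = ≤-trans (≤-reflexive (cong suc (toℕ-inject j))) (toℕ<n j)

  length-below : ∀ {n} (x : Fin n) → length (below x) ≡ toℕ x
  length-below x = trans (length-map inject (List.allFin (toℕ x))) (length-tabulate id)

  opposite-antitone : ∀ {n} {i j : Fin n} → i Fin.< j → opposite j Fin.< opposite i
  opposite-antitone {n} {i} {j} i<j = ≡.subst₂ _<_ (sym (opposite-prop j)) (sym (opposite-prop i))
    (ℕ.∸-monoʳ-< (s≤s i<j) (toℕ<n j))

  above : ∀ {n} → Fin n → List (Fin n)
  above x = List.map opposite (below (opposite x))

  ∈-above⁺ : ∀ {n} {x v : Fin n} → x Fin.< v → v ∈ above x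
  ∈-above⁺ {x = x} {v} x<v = subst (_∈ above x) (opposite-involutive v) (∈-map⁺ opposite (∈-below⁺ (opposite-antitone x<v)))

  ∈-above⁻ : ∀ {n} {x v : Fin n} → v ∈ above x → x Fin.< v
  ∈-above⁻ {x = x} v∈ with ∈-map⁻ opposite v∈
  ... | w , w∈ , refl = subst (Fin._< opposite w) (opposite-involutive x) (opposite-antitone (∈-below⁻ w∈))

  length-cartesianProduct : ∀ {A B : Set} (xs : List A) (ys : List B) → length (cartesianProduct xs ys) ≡ length xs * length ys
  length-cartesianProduct []       ys = refl
  length-cartesianProduct (x ∷ xs) ys = trans (length-++ (List.map (x ,_) ys))
    (cong₂ _+_ (length-map (x ,_) ys) (length-cartesianProduct xs ys))

  toℕ+opposite : ∀ {n} (x : Fin n) → suc (toℕ x + toℕ (opposite x)) ≡ n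
  toℕ+opposite x = trans (cong (suc (toℕ x) +_) (opposite-prop x)) (ℕ.m+[n∸m]≡n (toℕ<n x))

  toEdge-just⁻ : ∀ {d} {p : Fin d × Fin d} {e} → toEdge p ≡ just e → p ≡ (Edge.u e , Edge.v e)
  toEdge-just⁻ {p = a , b} eq with a Fin.<? b
  toEdge-just⁻ {p = a , b} refl | yes _ = refl

  u<v : ∀ {d} (e : Edge (K d)) → Edge.u e Fin.< Edge.v e
  u<v (edge u v u<v _) = recompute (u Fin.<? v) u<v

  module _ {d′ : ℕ} where

    private
      d = suc d′

    -- All pairs u ≤ x ≤ v except (x , x).
    pairs : Fin d → List (Fin d × Fin d)
    pairs x = List.map (x ,_) (above x) ++ cartesianProduct (below x) (x ∷ above x)

    -- Deduplication supplies `bag-unique`; it can only shorten the list, and only an upper bound on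
    -- the length is needed.
    pathBag : Fin d → List (Edge (K d))
    pathBag x = List.deduplicate _≟ᴱ_ (List.mapMaybe toEdge (pairs x))

    length-pathBag : ∀ x → length (pathBag x) ≤ suc (toℕ x) * toℕ (opposite x) + toℕ x
    length-pathBag x = begin
      length (pathBag x)                         ≤⟨ length-deduplicate _≟ᴱ_ (List.mapMaybe toEdge (pairs x)) ⟩
      length (List.mapMaybe toEdge (pairs x))    ≤⟨ length-mapMaybe toEdge (pairs x) ⟩
      length (pairs x)                           ≡⟨ length-++ (List.map (x ,_) (above x)) ⟩
      length (List.map (x ,_) (above x)) + length (cartesianProduct (below x) (x ∷ above x))
        ≡⟨ cong₂ _+_ (trans (length-map (x ,_) (above x)) length-above)
             (trans (length-cartesianProduct (below x) (x ∷ above x)) (cong₂ (λ a b → a * suc b) (length-below x) length-above)) ⟩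
      toℕ (opposite x) + toℕ x * suc (toℕ (opposite x))  ≡⟨ eq (toℕ x) (toℕ (opposite x)) ⟩
      suc (toℕ x) * toℕ (opposite x) + toℕ x ∎
      where
      open ℕ.≤-Reasoning
      length-above : length (above x) ≡ toℕ (opposite x)
      length-above = trans (length-map opposite (below (opposite x))) (length-below (opposite x))
      eq : ∀ a b → b + a * suc b ≡ suc a * b + a
      eq = solve-∀

    ∈-pathBag⁺ : ∀ {e x} → Edge.u e Fin.≤ x → x Fin.≤ Edge.v e → e ∈ pathBag x
    ∈-pathBag⁺ {e} {x} u≤x x≤v = ∈-deduplicate⁺ _≟ᴱ_ (∈-mapMaybe⁺ (by-cases (Edge.u e ≟ x) (Edge.v e ≟ x)) (toEdge-just e))
      where
      by-cases : Dec (Edge.u e ≡ x) → Dec (Edge.v e ≡ x) → (Edge.u e , Edge.v e) ∈ pairs x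
      by-cases (no u≢x) (no v≢x)  = ∈-++⁺ʳ (List.map (x ,_) (above x)) (∈-cartesianProduct⁺ (∈-below⁺ (Fin.≤∧≢⇒< u≤x u≢x)) (there (∈-above⁺ (Fin.≤∧≢⇒< x≤v (v≢x ∘ sym)))))
      by-cases (no u≢x) (yes v≡x) = ∈-++⁺ʳ (List.map (x ,_) (above x)) (∈-cartesianProduct⁺ (∈-below⁺ (Fin.≤∧≢⇒< u≤x u≢x)) (here v≡x))
      by-cases (yes refl) (no v≢x) = ∈-++⁺ˡ (∈-map⁺ (x ,_) (∈-above⁺ (Fin.≤∧≢⇒< x≤v (v≢x ∘ sym))))
      by-cases (yes u≡x) (yes v≡x) = contradiction (trans u≡x (sym v≡x)) (Fin.<⇒≢ (u<v e))

    ∈-pathBag⁻ : ∀ {e x} → e ∈ pathBag x → Edge.u e Fin.≤ x × x Fin.≤ Edge.v e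
    ∈-pathBag⁻ {e} {x} e∈ with ∈-mapMaybe⁻ {f = toEdge} {xs = pairs x} (∈-deduplicate⁻ _≟ᴱ_ _ e∈)
    ... | p , p∈ , eq with toEdge-just⁻ {p = p} eq | ∈-++⁻ (List.map (x ,_) (above x)) p∈
    ...   | refl | inj₁ p∈ˡ with ∈-map⁻ (x ,_) p∈ˡ
    ...     | v , v∈ , refl = ≤-refl , ℕ.<⇒≤ (∈-above⁻ v∈)
    ∈-pathBag⁻ {e} {x} e∈ | p , p∈ , eq | refl | inj₂ p∈ʳ with ∈-cartesianProduct⁻ (below x) (x ∷ above x) p∈ʳ
    ...     | u∈ , here refl = ℕ.<⇒≤ (∈-below⁻ u∈) , ≤-refl
    ...     | u∈ , there v∈  = ℕ.<⇒≤ (∈-below⁻ u∈) , ℕ.<⇒≤ (∈-above⁻ v∈)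

    -- The bags that contain an edge form the interval between its two ends, and edges with a common
    -- vertex x meet in the bag at x.
    pathDecomposition : TreeDecomposition (LineGraph (K d))
    pathDecomposition = record
      { nodes      = d
      ; tree       = path d′
      ; bag        = pathBag
      ; bag-unique = λ x → deduplicate-! _≟ᴱ_ (List.mapMaybe toEdge (pairs x))
      ; vertex-bag = λ e → Edge.u e , ∈-end e (inj₁ refl)
      ; edge-bag   = λ e f (_ , x , x∈e , x∈f) → x , ∈-end e x∈e , ∈-end f x∈f
      ; connected  = λ e x y x∈ y∈ → Star.reverse (λ (a , p , q) → TreeAdj-sym a , q , p) (fromLeft e x x∈) ◅◅ fromLeft e y y∈
      }
      where
      ∈-end : ∀ e {x} → x ∈ᴱ e → e ∈ pathBag x
      ∈-end e (inj₁ refl) = ∈-pathBag⁺ {e} ≤-refl (ℕ.<⇒≤ (u<v e))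
      ∈-end e (inj₂ refl) = ∈-pathBag⁺ {e} (ℕ.<⇒≤ (u<v e)) ≤-refl
      fromLeft : ∀ e x → e ∈ pathBag x → Star (λ a b → TreeAdj (path d′) a b × e ∈ pathBag a × e ∈ pathBag b) (Edge.u e) x
      fromLeft e = <-weakInduction P base step
        where
        P : Fin d → Set
        P x = e ∈ pathBag x → Star (λ a b → TreeAdj (path d′) a b × e ∈ pathBag a × e ∈ pathBag b) (Edge.u e) x
        base : P zero
        base e∈ = subst (Star _ (Edge.u e)) (toℕ-injective (ℕ.n≤0⇒n≡0 (proj₁ (∈-pathBag⁻ e∈)))) ε
        step : ∀ i → P (inject₁ i) → P (suc i)
        step i ih e∈ = by-cases (Edge.u e ≟ suc i)
          where
          by-cases : Dec (Edge.u e ≡ suc i) → _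
          by-cases (yes u≡) = subst (Star _ (Edge.u e)) u≡ ε
          by-cases (no u≢)  = ih e∈′ ◅◅ ((path-step i , e∈′ , e∈) ◅ ε)
            where
            e∈′ : e ∈ pathBag (inject₁ i)
            e∈′ = ∈-pathBag⁺ (≤-trans (ℕ.≤-pred (Fin.≤∧≢⇒< (proj₁ (∈-pathBag⁻ e∈)) u≢)) (≤-reflexive (sym (Fin.toℕ-inject₁ i))))
                    (≤-trans (≤-reflexive (Fin.toℕ-inject₁ i)) (≤-trans (ℕ.n≤1+n _) (proj₂ (∈-pathBag⁻ e∈))))

  foldr-⊔-lub : ∀ {m n} (f : Fin m → ℕ) → (∀ i → f i ≤ n) → VecF.foldr ℕ._⊔_ 0 f ≤ n
  foldr-⊔-lub {zero}  f h = z≤n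
  foldr-⊔-lub {suc m} f h = ℕ.⊔-lub (h zero) (foldr-⊔-lub (f ∘ suc) (h ∘ suc))

  ≤-foldr-⊔ : ∀ {m} (f : Fin m → ℕ) i → f i ≤ VecF.foldr ℕ._⊔_ 0 f
  ≤-foldr-⊔ f zero    = ℕ.m≤m⊔n (f zero) _
  ≤-foldr-⊔ f (suc i) = ≤-trans (≤-foldr-⊔ (f ∘ suc) i) (ℕ.m≤n⊔m (f zero) _)

  module _ {h g : ℕ} (g≤h : g ≤ h) (h≤1+g : h ≤ suc g) where

    transfer : ∀ x y t → y ≤ x → (x + t) * y ≤ x * (y + t)
    transfer x y t y≤x = begin
      (x + t) * y   ≡⟨ ℕ.*-distribʳ-+ y x t ⟩
      x * y + t * y ≤⟨ ℕ.+-monoʳ-≤ (x * y) (≤-trans (ℕ.*-monoʳ-≤ t y≤x) (≤-reflexive (ℕ.*-comm t x))) ⟩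
      x * y + x * t ≡⟨ ℕ.*-distribˡ-+ x y t ⟨
      x * (y + t)   ∎
      where open ℕ.≤-Reasoning

    -- By `transfer`, moving units from the larger to the smaller factor cannot decrease the
    -- product. Since h ≤ 1 + g, either j ≤ g or j ≥ h, so that one of the two directions always
    -- applies.
    balanced-product : ∀ j k → j + k ≡ h + g → suc j * suc k ≤ suc h * suc g
    balanced-product j k j+k with j ℕ.≤? g
    ... | yes j≤g = begin
      suc j * suc k                     ≡⟨ ℕ.*-comm (suc j) (suc k) ⟩
      suc k * suc j                     ≡⟨ cong (λ x → suc x * suc j) k≡ ⟩
      (suc h + (g ∸ j)) * suc j         ≤⟨ transfer (suc h) (suc j) (g ∸ j) (s≤s (≤-trans j≤g g≤h)) ⟩
      suc h * (suc j + (g ∸ j))         ≡⟨ cong (λ x → suc h * suc x) (ℕ.m+[n∸m]≡n j≤g) ⟩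
      suc h * suc g ∎
      where
      open ℕ.≤-Reasoning
      k≡ : k ≡ h + (g ∸ j)
      k≡ = ℕ.+-cancelˡ-≡ j k (h + (g ∸ j)) (trans j+k (trans (cong (h +_) (sym (ℕ.m+[n∸m]≡n j≤g))) (eq h j (g ∸ j))))
        where
        eq : ∀ h j t → h + (j + t) ≡ j + (h + t)
        eq = solve-∀
    ... | no j≰g = begin
      suc j * suc k                     ≡⟨ cong (λ x → suc x * suc k) (ℕ.m+[n∸m]≡n h≤j) ⟨
      (suc h + (j ∸ h)) * suc k         ≤⟨ transfer (suc h) (suc k) (j ∸ h) (s≤s k≤h) ⟩
      suc h * (suc k + (j ∸ h))         ≡⟨ cong (λ x → suc h * suc x) k+≡ ⟩
      suc h * suc g ∎
      where
      open ℕ.≤-Reasoning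
      h≤j : h ≤ j
      h≤j = ≤-trans h≤1+g (ℕ.≰⇒> j≰g)
      k+≡ : k + (j ∸ h) ≡ g
      k+≡ = ℕ.+-cancelˡ-≡ h (k + (j ∸ h)) g (trans (eq h k (j ∸ h)) (trans (cong (_+ k) (ℕ.m+[n∸m]≡n h≤j)) j+k))
        where
        eq : ∀ h k t → h + (k + t) ≡ h + t + k
        eq = solve-∀
      k≤h : k ≤ h
      k≤h = ≤-trans (ℕ.m≤m+n k (j ∸ h)) (≤-trans (≤-reflexive k+≡) g≤h)

    -- After adding 1, both sides factor, with equal sums of the two factors. The bound serves
    -- twice: for the bags of the path and for the loops of the contraction.
    cut≤ : ∀ j k → suc (j + k) ≡ suc (h + g) → suc j * k + j ≤ h * g + h + g
    cut≤ j k j+k = ℕ.≤-pred (begin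
      suc (suc j * k + j)    ≡⟨ eq j k ⟩
      suc j * suc k          ≤⟨ balanced-product j k (ℕ.suc-injective j+k) ⟩
      suc h * suc g          ≡⟨ eq′ h g ⟩
      suc (h * g + h + g)    ∎)
      where
      open ℕ.≤-Reasoning
      eq : ∀ j k → suc (suc j * k + j) ≡ suc j * suc k
      eq = solve-∀
      eq′ : ∀ h g → suc h * suc g ≡ suc (h * g + h + g)
      eq′ = solve-∀

    width≥ : ∀ w → suc w ≡ h * g + h + g → (D : TreeDecomposition (LineGraph (K (suc (h + g))))) → w ≤ TreeDecomposition.width D
    width≥ w w≡ D = by-cases g refl
      where
      open TreeDecomposition D
      by-cases : ∀ g₀ → g ≡ g₀ → w ≤ width
      -- With g = 0 also h ≤ 1, so w = 0; the bramble argument needs g ≥ 1.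
      by-cases zero refl = ≤-trans (ℕ.≤-pred (≤-trans (≤-reflexive w≡) (≤-trans (≤-reflexive (trans (ℕ.+-identityʳ _) (cong (_+ h) (ℕ.*-zeroʳ h)))) h≤1+g))) z≤n
      by-cases (suc g′) refl with w ℕ.≤? width
      ... | yes w≤ = w≤
      ... | no  w≰ = ⊥-elim (LowerBound.bags-not-small zero refl g≤h h≤1+g D small)
        where
        small : ∀ x → length (bag x) < h * g + h + g
        -- `width` is one less than the largest bag, truncated at 0, so a bag has at most 1 +
        -- `width` elements.
        small x = ≤-trans (s≤s (≤-trans (≤-trans (≤-foldr-⊔ (λ x → length (bag x)) x) (ℕ.m≤n+m∸n _ 1)) (ℕ.≰⇒> w≰))) (≤-reflexive w≡)

    treewidth : ∀ w → suc w ≡ h * g + h + g → IsTreewidth (LineGraph (K (suc (h + g)))) w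
    treewidth w w≡ = (D , ℕ.≤-antisym width≤ (width≥ w w≡ D)) , width≥ w w≡
      where
      D = pathDecomposition {h + g}
      width≤ : TreeDecomposition.width D ≤ w
      width≤ = ℕ.∸-monoˡ-≤ 1 (≤-trans (foldr-⊔-lub (λ x → length (pathBag x)) λ x →
        ≤-trans (length-pathBag x) (cut≤ (toℕ x) (toℕ (opposite x)) (toℕ+opposite x))) (≤-reflexive (sym w≡)))

-- Arithmetic of the rational exponents.

open import Data.Integer.Base using (+_; -1ℤ)
open import Data.Rational.Base using (_+_; _-_; _*_; _/_)
open import Algebra.Properties.Group ℚ.+-0-group using (x≈z//y)

/-≡ : ∀ a b c e → a ℕ.* suc e ≡ c ℕ.* suc b → + a / suc b ≡ + c / suc e
/-≡ a b c e eq = ℚ.fromℚᵘ-cong {mkℚᵘ (+ a) b} {mkℚᵘ (+ c) e}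
  (*≡* (trans (sym (ℤ.pos-* a (suc e))) (trans (cong +_ eq) (ℤ.pos-* c (suc b)))))

/-* : ∀ a b c e → (+ a / suc b) * (+ c / suc e) ≡ + (a ℕ.* c) / (suc b ℕ.* suc e)
/-* a b c e = ℚ.toℚᵘ-injective (ℚᵘ.≃-trans (ℚ.toℚᵘ-homo-* (+ a / suc b) (+ c / suc e))
  (ℚᵘ.≃-trans (ℚᵘ.*-cong (ℚ.toℚᵘ-fromℚᵘ (mkℚᵘ (+ a) b)) (ℚ.toℚᵘ-fromℚᵘ (mkℚᵘ (+ c) e)))
  (ℚᵘ.≃-trans (ℚᵘ.≃-reflexive (cong (λ x → x ℚᵘ./ (suc b ℕ.* suc e)) (sym (ℤ.pos-* a c))))
  (ℚᵘ.≃-sym (ℚ.toℚᵘ-fromℚᵘ _)))))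

/-+ : ∀ a b c e → (+ a / suc b) + (+ c / suc e) ≡ + (a ℕ.* suc e ℕ.+ c ℕ.* suc b) / (suc b ℕ.* suc e)
/-+ a b c e = ℚ.toℚᵘ-injective (ℚᵘ.≃-trans (ℚ.toℚᵘ-homo-+ (+ a / suc b) (+ c / suc e))
  (ℚᵘ.≃-trans (ℚᵘ.+-cong (ℚ.toℚᵘ-fromℚᵘ (mkℚᵘ (+ a) b)) (ℚ.toℚᵘ-fromℚᵘ (mkℚᵘ (+ c) e)))
  (ℚᵘ.≃-trans (ℚᵘ.≃-reflexive (cong₂ (λ x y → (x ℤ.+ y) ℚᵘ./ (suc b ℕ.* suc e)) (sym (ℤ.pos-* a (suc e))) (sym (ℤ.pos-* c (suc b)))))
  (ℚᵘ.≃-sym (ℚ.toℚᵘ-fromℚᵘ _)))))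

-- Growth exponents are tested on the reduced numerator and denominator of β, which do not compute
-- for a symbolic quotient; cross-multiplication is all that the growth lemmas ask for.
cross : ∀ a b {β} → β ≡ + a / suc b → a ℕ.* ↧ₙ β ≡ ∣ ↥ β ∣ ℕ.* suc b
cross a b {β} refl = begin
  ∣ + a ∣ ℕ.* ∣ ↧ β ∣       ≡⟨ ℤ.abs-* (+ a) (↧ β) ⟨
  ∣ + a ℤ.* ↧ β ∣           ≡⟨ cong ∣_∣ (ℚᵘ.drop-*≡* (unfold β (ℚ.toℚᵘ-fromℚᵘ (mkℚᵘ (+ a) b)))) ⟨
  ∣ ↥ β ℤ.* + suc b ∣       ≡⟨ ℤ.abs-* (↥ β) (+ suc b) ⟩
  ∣ ↥ β ∣ ℕ.* suc b         ∎
  where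
  open ≡.≡-Reasoning
  unfold : ∀ β → toℚᵘ β ℚᵘ.≃ mkℚᵘ (+ a) b → mkℚᵘ (↥ β) (ℚ.ℚ.denominator-1 β) ℚᵘ.≃ mkℚᵘ (+ a) b
  unfold (ℚ.mkℚ _ _ _) p = p

/-nonNeg : ∀ a b {β} → β ≡ + a / suc b → ℚ.NonNegative β
/-nonNeg a b refl = ℚ.normalize-nonNeg a (suc b)

-- With d = n + 1, multiplication by 4 d turns the claim into 8 E + c = 2 d (d + 2). The intended c
-- is 7 + (-1)^d.
exponent-identity : ∀ n E c → 8 ℕ.* E ℕ.+ c ≡ 2 ℕ.* (suc n ℕ.* (3 ℕ.+ n)) →
  (+ 2 / suc n) * (+ E / 1) ≡ (+ suc n / 2) + 1ℚ - (+ c / (4 ℕ.* suc n))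
exponent-identity n E c h = x≈z//y _ _ _ (begin
  (+ 2 / suc n) * (+ E / 1) + (+ c / (4 ℕ.* suc n))
    ≡⟨ cong (_+ (+ c / (4 ℕ.* suc n))) (/-* 2 n E 0) ⟩
  (+ (2 ℕ.* E) / (suc n ℕ.* 1)) + (+ c / (4 ℕ.* suc n))
    ≡⟨ /-+ (2 ℕ.* E) (n ℕ.* 1) c (n ℕ.+ 3 ℕ.* suc n) ⟩
  + (2 ℕ.* E ℕ.* (4 ℕ.* suc n) ℕ.+ c ℕ.* (suc n ℕ.* 1)) / (suc n ℕ.* 1 ℕ.* (4 ℕ.* suc n))
    ≡⟨ /-≡ (2 ℕ.* E ℕ.* (4 ℕ.* suc n) ℕ.+ c ℕ.* (suc n ℕ.* 1)) _ (suc n ℕ.* 1 ℕ.+ 1 ℕ.* 2) 1 clear ⟩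
  + (suc n ℕ.* 1 ℕ.+ 1 ℕ.* 2) / (2 ℕ.* 1)
    ≡⟨ /-+ (suc n) 1 1 0 ⟨
  (+ suc n / 2) + 1ℚ ∎)
  where
  open ≡.≡-Reasoning
  eq₁ : ∀ n E c → (2 ℕ.* E ℕ.* (4 ℕ.* suc n) ℕ.+ c ℕ.* (suc n ℕ.* 1)) ℕ.* 2 ≡ 2 ℕ.* suc n ℕ.* (8 ℕ.* E ℕ.+ c)
  eq₁ = solve-∀
  eq₂ : ∀ n → 2 ℕ.* suc n ℕ.* (2 ℕ.* (suc n ℕ.* (3 ℕ.+ n))) ≡ (suc n ℕ.* 1 ℕ.+ 1 ℕ.* 2) ℕ.* (suc n ℕ.* 1 ℕ.* (4 ℕ.* suc n))
  eq₂ = solve-∀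
  clear : (2 ℕ.* E ℕ.* (4 ℕ.* suc n) ℕ.+ c ℕ.* (suc n ℕ.* 1)) ℕ.* 2 ≡ (suc n ℕ.* 1 ℕ.+ 1 ℕ.* 2) ℕ.* (suc n ℕ.* 1 ℕ.* (4 ℕ.* suc n))
  clear = trans (eq₁ n E c) (trans (cong (2 ℕ.* suc n ℕ.*_) h) (eq₂ n))

[-1]^even : ∀ g → -1ℤ ℤ.^ (g ℕ.+ g) ≡ + 1
[-1]^even zero    = refl
[-1]^even (suc g) = begin
  -1ℤ ℤ.* -1ℤ ℤ.^ (g ℕ.+ suc g)           ≡⟨ cong (λ k → -1ℤ ℤ.* -1ℤ ℤ.^ k) (ℕ.+-suc g g) ⟩
  -1ℤ ℤ.* (-1ℤ ℤ.* -1ℤ ℤ.^ (g ℕ.+ g))     ≡⟨ cong (λ x → -1ℤ ℤ.* (-1ℤ ℤ.* x)) ([-1]^even g) ⟩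
  + 1 ∎
  where open ≡.≡-Reasoning

-- Matching on it puts d into the form suc (h + g) with h = g or h = suc g definitionally, so that
-- the tensor need not be transported.
data Halves : ℕ → Set where
  odd  : ∀ g → Halves (suc (g ℕ.+ g))
  even : ∀ g → Halves (suc (suc g ℕ.+ g))

halves : ∀ n → Halves (suc n)
halves zero    = odd 0
halves (suc n) with halves n
... | odd g  = even g
... | even g = subst Halves (cong (λ k → suc (suc k)) (ℕ.+-suc g g)) (odd (suc g))

p<p+ε : ∀ p ε → ℚ.Positive ε → p ℚ.< p + ε
p<p+ε p ε ε>0 = subst (ℚ._< p + ε) (ℚ.+-identityʳ p) (ℚ.+-monoʳ-< p (ℚ.positive⁻¹ ε {{ε>0}}))

unit<ε : ∀ ε → ℚ.Positive ε → + 1 / suc (↧ₙ ε) ℚ.< ε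
unit<ε ε@(ℚ.mkℚ (+ suc a) b _) _ = ℚ.toℚᵘ-cancel-< (ℚᵘ.<-respˡ-≃ (ℚᵘ.≃-sym (ℚ.toℚᵘ-fromℚᵘ (mkℚᵘ (+ 1) (suc b)))) (*<* (ℤ.+<+ (begin-strict
  1 ℕ.* suc b         ≡⟨ ℕ.*-identityˡ (suc b) ⟩
  suc b               <⟨ ≤-refl ⟩
  suc (suc b)         ≤⟨ ℕ.m≤m+n (suc (suc b)) (a ℕ.* suc (suc b)) ⟩
  suc a ℕ.* suc (suc b) ∎))))
  where open ℕ.≤-Reasoning

-- The bound on η and the theorem.

module _ {c ℓ₁ ℓ₂} (𝔽 : HeytingField c ℓ₁ ℓ₂) {n : ℕ} .{{_ : ℕ.NonZero n}} where

  open Growth 𝔽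
  open LineGraphTreewidth using (treewidth; cut≤)

  -- The exponents (L + 1) / L only approach 1, so L has to depend on ε: a positive ε has numerator
  -- at least 1, hence exceeds 1 / L when L is one more than its denominator.
  η-matrix : (T : Tensor 𝔽 2 n) → η[_]≤_ 𝔽 T 1ℚ
  η-matrix T ε ε>0 = β , growth-matrix T L β (/-nonNeg (suc L) (↧ₙ ε) {β} refl) (≤-reflexive (cross (suc L) (↧ₙ ε) {β} refl)) , β<
    where
    L = suc (↧ₙ ε)
    β = + suc L / L
    β≡ : 1ℚ + (+ 1 / L) ≡ β
    β≡ = trans (/-+ 1 0 1 (↧ₙ ε)) (/-≡ (1 ℕ.* L ℕ.+ 1 ℕ.* 1) (↧ₙ ε ℕ.+ 0) (suc L) (↧ₙ ε) (eq (↧ₙ ε)))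
      where
      eq : ∀ m → (1 ℕ.* suc m ℕ.+ 1 ℕ.* 1) ℕ.* suc m ≡ suc (suc m) ℕ.* suc (m ℕ.+ 0)
      eq = solve-∀
    β< : β ℚ.< 1ℚ + ε
    β< = subst (ℚ._< 1ℚ + ε) β≡ (ℚ.+-monoʳ-< 1ℚ (unit<ε ε ε>0))

  η-star : ∀ {h g} → suc g ≤ h → h ≤ suc (suc g) → (T : Tensor 𝔽 (suc (h ℕ.+ suc g)) n) →
    η[_]≤_ 𝔽 T ((+ 2 / suc (h ℕ.+ suc g)) * (+ (h ℕ.* suc g ℕ.+ h ℕ.+ suc g) / 1))
  η-star {h} {g} g≤h h≤1+g T ε ε>0 = q ,
    growth-star T E q (/-nonNeg (2 ℕ.* E) d′ q≡) d≤E (cut≤ g≤h h≤1+g) (≤-reflexive (cross (2 ℕ.* E) d′ q≡)) ,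
    p<p+ε q ε ε>0
    where
    d′ = h ℕ.+ suc g
    E = h ℕ.* suc g ℕ.+ h ℕ.+ suc g
    q = (+ 2 / suc d′) * (+ E / 1)
    q≡ : q ≡ + (2 ℕ.* E) / suc d′
    q≡ = trans (/-* 2 d′ E 0) (/-≡ (2 ℕ.* E) (d′ ℕ.* 1) (2 ℕ.* E) d′ (cong (λ k → 2 ℕ.* E ℕ.* suc k) (sym (ℕ.*-identityʳ d′))))
    d≤E : suc d′ ≤ E
    -- The product h (g + 1) ≥ 1 makes up for the one by which d exceeds h + (g + 1).
    d≤E = ≤-trans (ℕ.+-monoˡ-≤ d′ (ℕ.*-mono-≤ (≤-trans (s≤s z≤n) g≤h) (s≤s (z≤n {g})))) (≤-reflexive (sym (ℕ.+-assoc (h ℕ.* suc g) h (suc g))))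

  η-bound : ∀ h g → g ≤ h → h ≤ suc g → 1 ≤ h → (T : Tensor 𝔽 (suc (h ℕ.+ g)) n) →
    η[_]≤_ 𝔽 T ((+ 2 / suc (h ℕ.+ g)) * (+ (h ℕ.* g ℕ.+ h ℕ.+ g) / 1))
  η-bound h               (suc g) g≤h h≤1+g _   T = η-star g≤h h≤1+g T
  η-bound (suc zero)      zero    _   _     _   T = η-matrix T
  η-bound (suc (suc _))   zero    _ (s≤s ()) _ T

  theorem-halves : ∀ h g r → g ≤ h → h ≤ suc g → 1 ≤ h → (T : Tensor 𝔽 (suc (h ℕ.+ g)) n) →
    + 7 ℤ.+ -1ℤ ℤ.^ suc (h ℕ.+ g) ≡ + r →
    8 ℕ.* (h ℕ.* g ℕ.+ h ℕ.+ g) ℕ.+ r ≡ 2 ℕ.* (suc (h ℕ.+ g) ℕ.* (3 ℕ.+ (h ℕ.+ g))) →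
    Σ[ ltw ∈ ℕ ] IsTreewidth (LineGraph (K (suc (h ℕ.+ g)))) ltw ×
      (η[_]≤_ 𝔽 T ((+ 2 / suc (h ℕ.+ g)) * (+ suc ltw / 1))) ×
      ((+ 2 / suc (h ℕ.+ g)) * (+ suc ltw / 1) ≡
        (+ suc (h ℕ.+ g) / 2) + 1ℚ - (+ 7 ℤ.+ -1ℤ ℤ.^ suc (h ℕ.+ g)) / (4 ℕ.* suc (h ℕ.+ g)))
  theorem-halves h g r g≤h h≤1+g 1≤h T sign count = ltw , treewidth g≤h h≤1+g ltw ltw≡ ,
    subst (λ E → η[_]≤_ 𝔽 T ((+ 2 / suc (h ℕ.+ g)) * (+ E / 1))) (sym ltw≡) (η-bound h g g≤h h≤1+g 1≤h T) ,
    trans (cong (λ E → (+ 2 / suc (h ℕ.+ g)) * (+ E / 1)) ltw≡)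
      (trans (exponent-identity (h ℕ.+ g) (h ℕ.* g ℕ.+ h ℕ.+ g) r count)
        (cong (λ z → (+ suc (h ℕ.+ g) / 2) + 1ℚ - z / (4 ℕ.* suc (h ℕ.+ g))) (sym sign)))
    where
    ltw = ℕ.pred (h ℕ.* g ℕ.+ h ℕ.+ g)
    ltw≡ : suc ltw ≡ h ℕ.* g ℕ.+ h ℕ.+ g
    ltw≡ = ℕ.suc-pred _ {{ℕ.>-nonZero (≤-trans 1≤h (≤-trans (ℕ.m≤n+m h (h ℕ.* g)) (ℕ.m≤m+n _ g)))}}

theorem31 : ∀ {c ℓ₁ ℓ₂} (𝔽 : HeytingField c ℓ₁ ℓ₂) (d n : ℕ) .{{_ : ℕ.NonZero d}} →
    2 ≤ d → 1 ≤ n → (T : Tensor 𝔽 d n) →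
    Σ[ ltw ∈ ℕ ] IsTreewidth (LineGraph (K d)) ltw ×
    (η[_]≤_ 𝔽 T ((+ 2 / d) * (+ suc ltw / 1))) ×
    ((+ 2 / d) * (+ suc ltw / 1) ≡
    (+ d / 2) + 1ℚ - _/_ (+ 7 ℤ.+ -1ℤ ℤ.^ d) (4 ℕ.* d) {{m*n≢0 4 d}})
theorem31 𝔽 (suc d) n 2≤d 1≤n T with halves d
... | odd zero    = ⊥-elim (ℕ.<-irrefl refl 2≤d)
-- The witness 6 here and 8 in the even case are the values of 7 + (-1)^d.
... | odd (suc g) = theorem-halves 𝔽 {{ℕ.>-nonZero 1≤n}} (suc g) (suc g) 6 ≤-refl (ℕ.n≤1+n _) (s≤s z≤n) T
  (cong (λ z → + 7 ℤ.+ -1ℤ ℤ.* z) ([-1]^even (suc g))) (eq (suc g))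
  where
  eq : ∀ g → 8 ℕ.* (g ℕ.* g ℕ.+ g ℕ.+ g) ℕ.+ 6 ≡ 2 ℕ.* (suc (g ℕ.+ g) ℕ.* (3 ℕ.+ (g ℕ.+ g)))
  eq = solve-∀
... | even g      = theorem-halves 𝔽 {{ℕ.>-nonZero 1≤n}} (suc g) g 8 (ℕ.n≤1+n g) ≤-refl (s≤s z≤n) T
  (cong (λ z → + 7 ℤ.+ -1ℤ ℤ.* (-1ℤ ℤ.* z)) ([-1]^even g)) (eq g)
  where
  eq : ∀ g → 8 ℕ.* (suc g ℕ.* g ℕ.+ suc g ℕ.+ g) ℕ.+ 8 ≡ 2 ℕ.* (suc (suc g ℕ.+ g) ℕ.* (3 ℕ.+ (suc g ℕ.+ g)))
  eq = solve-∀
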